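{- For every non-negative integer $d$, $$\sum_{a\in A_+(d)}\frac{\chi_t(a)}{a}=(-1)^d\frac{b_d(\chi_t)}{L_d}\quad\text{in } K[t].$$
   Context: $q$ is a power of a prime, $A=\mathbb{F}_q[\theta]$, $K=\mathbb{F}_q(\theta)$, $A_+(d)$ is the set of monic polynomials of degree $d$ in $A$. $t$ is an indeterminate and $\chi_t:A\to A[t]$ is the $\mathbb{F}_q$-algebra morphism with $\theta\mapsto t$. $D_d$ is the product of all monic polynomials of degree $d$ in $A$, $L_d$ is the least common multiple of all polynomials of degree $d$ in $A$, and $D_0=L_0=1$. For $f:A\to A[t]$, $M_d(f)(z):=\sum_{b\in A_+(d)} f(b)\prod_{a\in A_+(d)\setminus\{b\}}(z-a)\in A[t][z]$. The Wagner coefficients are $b_d(\chi_t):=(-1)^d\frac{L_d}{D_d}M_d(\chi_t)(0)\in K[t]$. -}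

module Defs where

open import Algebra.Bundles using (CommutativeRing)
open import Algebra.Morphism.Structures using (module RingMorphisms)
open import Data.Empty using (⊥-elim)
open import Data.Fin.Base using (Fin)
import Data.Fin.Properties as Fin
open import Data.List.Base using (List; []; _∷_; map; foldr; filter; allFin; cartesianProductWith)
import Data.List.Membership.Setoid as SetoidMembership
import Data.List.Membership.Setoid.Properties as SetoidMembershipₚ
import Data.List.Membership.Propositional.Properties as Membershipₚ
open import Data.List.Relation.Unary.All as All using (All; []; _∷_)
open import Data.List.Relation.Unary.AllPairs using ([]; _∷_)
open import Data.List.Relation.Unary.Any as Any using (Any; here; there)
import Data.List.Relation.Unary.Unique.Setoid as SetoidUnique
import Data.List.Relation.Unary.Unique.Setoid.Properties as SetoidUniqueₚ
import Data.List.Relation.Unary.Unique.Propositional.Properties as Uniqueₚ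
open import Data.Nat.Base as ℕ using (ℕ; zero; suc; s≤s; z≤n)
import Data.Nat.Properties as ℕ
open import Data.Nat.Primality using (Prime)
open import Data.Product.Base using (Σ; ∃; ∃₂; _×_; _,_; proj₁; proj₂)
open import Data.Sum.Base using (_⊎_; inj₁; inj₂)
open import Function.Base using (id)
open import Function.Bundles using (Inverse)
open import Level using (Level; _⊔_) renaming (suc to lsuc)
open import Relation.Binary.Bundles using (Setoid)
open import Relation.Binary.Definitions using (Decidable)
open import Relation.Binary.PropositionalEquality as ≡ using (_≡_)
open import Relation.Nullary using (¬_; Dec; yes; no)
open import Relation.Nullary.Decidable using (¬?; map′)

private
  variable
    i c ℓ c′ ℓ′ : Level

∑ : {I : Set i} (R : CommutativeRing c ℓ) →
    List I → (I → CommutativeRing.Carrier R) → CommutativeRing.Carrier R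
∑ R xs f = foldr _+_ 0# (map f xs)
  where open CommutativeRing R

∏ : {I : Set i} (R : CommutativeRing c ℓ) →
    List I → (I → CommutativeRing.Carrier R) → CommutativeRing.Carrier R
∏ R xs f = foldr _*_ 1# (map f xs)
  where open CommutativeRing R

-- A polynomial is its list of coefficients, constant term first.  Trailing
-- zeros are allowed, so equality is equality of all coefficients.
module Polynomial (R : CommutativeRing c ℓ) where

  open CommutativeRing R
  open import Algebra.Properties.Ring ring using (-0#≈0#)
  open import Algebra.Properties.CommutativeSemigroup +-commutativeSemigroup using (interchange; x∙yz≈y∙xz)

  Poly : Set c
  Poly = List Carrier

  coeff : Poly → ℕ → Carrier
  coeff []      _       = 0#
  coeff (a ∷ p) zero    = a
  coeff (a ∷ p) (suc n) = coeff p n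

  infix 4 _≋_

  record _≋_ (p q : Poly) : Set ℓ where
    constructor mk≋
    field
      coeff≈ : ∀ n → coeff p n ≈ coeff q n

  open _≋_ public

  const : Carrier → Poly
  const a = a ∷ []

  X : Poly
  X = 0# ∷ 1# ∷ []

  scale : Carrier → Poly → Poly
  scale a = map (a *_)

  infixl 6 _⊕_
  infixl 7 _⊗_

  _⊕_ : Poly → Poly → Poly
  []      ⊕ q       = q
  (a ∷ p) ⊕ []      = a ∷ p
  (a ∷ p) ⊕ (b ∷ q) = a + b ∷ p ⊕ q

  neg : Poly → Poly
  neg = map (-_)

  _⊗_ : Poly → Poly → Poly
  []      ⊗ q = []
  (a ∷ p) ⊗ q = scale a q ⊕ (0# ∷ p ⊗ q)

  ≋-refl : ∀ {p} → p ≋ p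
  ≋-refl = mk≋ λ _ → refl

  ≋-sym : ∀ {p q} → p ≋ q → q ≋ p
  ≋-sym e = mk≋ λ n → sym (coeff≈ e n)

  ≋-trans : ∀ {p q r} → p ≋ q → q ≋ r → p ≋ r
  ≋-trans e f = mk≋ λ n → trans (coeff≈ e n) (coeff≈ f n)

  ≋-setoid : Setoid c ℓ
  ≋-setoid = record
    { Carrier = Poly ; _≈_ = _≋_
    ; isEquivalence = record { refl = ≋-refl ; sym = ≋-sym ; trans = ≋-trans } }

  ∷-cong : ∀ {a b p q} → a ≈ b → p ≋ q → a ∷ p ≋ b ∷ q
  ∷-cong e f = mk≋ λ { zero → e ; (suc n) → coeff≈ f n }

  ∷-injectiveʳ : ∀ {a b p q} → a ∷ p ≋ b ∷ q → p ≋ q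
  ∷-injectiveʳ e = mk≋ λ n → coeff≈ e (suc n)

  ∷-zero : ∀ {a p} → a ≈ 0# → p ≋ [] → a ∷ p ≋ []
  ∷-zero e f = mk≋ λ { zero → e ; (suc n) → coeff≈ f n }

  ∷-zero⁻ : ∀ {a p} → a ∷ p ≋ [] → p ≋ []
  ∷-zero⁻ e = mk≋ λ n → coeff≈ e (suc n)

  coeff-⊕ : ∀ p q n → coeff (p ⊕ q) n ≈ coeff p n + coeff q n
  coeff-⊕ []      q       n       = sym (+-identityˡ _)
  coeff-⊕ (a ∷ p) []      n       = sym (+-identityʳ _)
  coeff-⊕ (a ∷ p) (b ∷ q) zero    = refl
  coeff-⊕ (a ∷ p) (b ∷ q) (suc n) = coeff-⊕ p q n

  coeff-neg : ∀ p n → coeff (neg p) n ≈ - coeff p n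
  coeff-neg []      n       = sym -0#≈0#
  coeff-neg (a ∷ p) zero    = refl
  coeff-neg (a ∷ p) (suc n) = coeff-neg p n

  coeff-scale : ∀ a p n → coeff (scale a p) n ≈ a * coeff p n
  coeff-scale a []      n       = sym (zeroʳ a)
  coeff-scale a (b ∷ p) zero    = refl
  coeff-scale a (b ∷ p) (suc n) = coeff-scale a p n

  ⊕-cong : ∀ {p p′ q q′} → p ≋ p′ → q ≋ q′ → p ⊕ q ≋ p′ ⊕ q′
  ⊕-cong {p} {p′} {q} {q′} e f = mk≋ λ n →
    trans (coeff-⊕ p q n) (trans (+-cong (coeff≈ e n) (coeff≈ f n)) (sym (coeff-⊕ p′ q′ n)))

  ⊕-assoc : ∀ p q r → (p ⊕ q) ⊕ r ≋ p ⊕ (q ⊕ r)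
  ⊕-assoc p q r = mk≋ λ n →
    trans (coeff-⊕ (p ⊕ q) r n) (trans (+-congʳ (coeff-⊕ p q n)) (trans (+-assoc _ _ _)
    (sym (trans (coeff-⊕ p (q ⊕ r) n) (+-congˡ (coeff-⊕ q r n))))))

  ⊕-comm : ∀ p q → p ⊕ q ≋ q ⊕ p
  ⊕-comm p q = mk≋ λ n →
    trans (coeff-⊕ p q n) (trans (+-comm _ _) (sym (coeff-⊕ q p n)))

  ⊕-identityʳ : ∀ p → p ⊕ [] ≋ p
  ⊕-identityʳ p = ⊕-comm p []

  neg-cong : ∀ {p q} → p ≋ q → neg p ≋ neg q
  neg-cong {p} {q} e = mk≋ λ n →
    trans (coeff-neg p n) (trans (-‿cong (coeff≈ e n)) (sym (coeff-neg q n)))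

  neg-inverseˡ : ∀ p → neg p ⊕ p ≋ []
  neg-inverseˡ p = mk≋ λ n →
    trans (coeff-⊕ (neg p) p n) (trans (+-congʳ (coeff-neg p n)) (-‿inverseˡ _))

  neg-inverseʳ : ∀ p → p ⊕ neg p ≋ []
  neg-inverseʳ p = ≋-trans (⊕-comm p (neg p)) (neg-inverseˡ p)

  ⊕-interchange : ∀ p q r s → (p ⊕ q) ⊕ (r ⊕ s) ≋ (p ⊕ r) ⊕ (q ⊕ s)
  ⊕-interchange p q r s = mk≋ λ n →
    trans (coeff-⊕ (p ⊕ q) (r ⊕ s) n) (trans (+-cong (coeff-⊕ p q n) (coeff-⊕ r s n))
    (trans (interchange _ _ _ _)
    (sym (trans (coeff-⊕ (p ⊕ r) (q ⊕ s) n) (+-cong (coeff-⊕ p r n) (coeff-⊕ q s n))))))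

  ⊕-swap : ∀ p q r → p ⊕ (q ⊕ r) ≋ q ⊕ (p ⊕ r)
  ⊕-swap p q r = mk≋ λ n →
    trans (coeff-⊕ p (q ⊕ r) n) (trans (+-congˡ (coeff-⊕ q r n)) (trans (x∙yz≈y∙xz _ _ _)
    (sym (trans (coeff-⊕ q (p ⊕ r) n) (+-congˡ (coeff-⊕ p r n))))))

  shift-⊕ : ∀ p q → 0# ∷ (p ⊕ q) ≋ (0# ∷ p) ⊕ (0# ∷ q)
  shift-⊕ p q = ∷-cong (sym (+-identityˡ 0#)) ≋-refl

  scale-cong : ∀ {a b p q} → a ≈ b → p ≋ q → scale a p ≋ scale b q
  scale-cong {a} {b} {p} {q} e f = mk≋ λ n →
    trans (coeff-scale a p n) (trans (*-cong e (coeff≈ f n)) (sym (coeff-scale b q n)))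

  scale-⊕ : ∀ a p q → scale a (p ⊕ q) ≋ scale a p ⊕ scale a q
  scale-⊕ a p q = mk≋ λ n →
    trans (coeff-scale a (p ⊕ q) n) (trans (*-congˡ (coeff-⊕ p q n)) (trans (distribˡ _ _ _)
    (sym (trans (coeff-⊕ (scale a p) (scale a q) n) (+-cong (coeff-scale a p n) (coeff-scale a q n))))))

  scale-+ : ∀ a b p → scale (a + b) p ≋ scale a p ⊕ scale b p
  scale-+ a b p = mk≋ λ n →
    trans (coeff-scale (a + b) p n) (trans (distribʳ _ _ _)
    (sym (trans (coeff-⊕ (scale a p) (scale b p) n) (+-cong (coeff-scale a p n) (coeff-scale b p n)))))

  scale-* : ∀ a b p → scale (a * b) p ≋ scale a (scale b p)
  scale-* a b p = mk≋ λ n →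
    trans (coeff-scale (a * b) p n) (trans (*-assoc _ _ _)
    (sym (trans (coeff-scale a (scale b p) n) (*-congˡ (coeff-scale b p n)))))

  scale-zero : ∀ {a} p → a ≈ 0# → scale a p ≋ []
  scale-zero {a} p e = mk≋ λ n → trans (coeff-scale a p n) (trans (*-congʳ e) (zeroˡ _))

  scale-one : ∀ p → scale 1# p ≋ p
  scale-one p = mk≋ λ n → trans (coeff-scale 1# p n) (*-identityˡ _)

  ⊗-zeroʳ : ∀ p → p ⊗ [] ≋ []
  ⊗-zeroʳ []      = ≋-refl
  ⊗-zeroʳ (a ∷ p) = ∷-zero refl (⊗-zeroʳ p)

  ⊗-zeroˡ : ∀ {p} q → p ≋ [] → p ⊗ q ≋ []
  ⊗-zeroˡ {[]}    q e = ≋-refl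
  ⊗-zeroˡ {a ∷ p} q e =
    ⊕-cong {q = 0# ∷ p ⊗ q} (scale-zero q (coeff≈ e 0)) (∷-zero refl (⊗-zeroˡ q (∷-zero⁻ e)))

  ⊗-∷ : ∀ p b q → p ⊗ (b ∷ q) ≋ scale b p ⊕ (0# ∷ p ⊗ q)
  ⊗-∷ []      b q = mk≋ λ { zero → refl ; (suc n) → refl }
  ⊗-∷ (a ∷ p) b q = ∷-cong (+-congʳ (*-comm a b))
    (≋-trans (⊕-cong (≋-refl {scale a q}) (⊗-∷ p b q)) (⊕-swap (scale a q) (scale b p) (0# ∷ p ⊗ q)))

  ⊗-comm : ∀ p q → p ⊗ q ≋ q ⊗ p
  ⊗-comm []      q = ≋-sym (⊗-zeroʳ q)
  ⊗-comm (a ∷ p) q =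
    ≋-trans (⊕-cong (≋-refl {scale a q}) (∷-cong refl (⊗-comm p q))) (≋-sym (⊗-∷ q a p))

  ⊗-congʳ : ∀ {p p′} q → p ≋ p′ → p ⊗ q ≋ p′ ⊗ q
  ⊗-congʳ {[]}    {p′}     q e = ≋-sym (⊗-zeroˡ q (≋-sym e))
  ⊗-congʳ {a ∷ p} {[]}     q e = ⊗-zeroˡ q e
  ⊗-congʳ {a ∷ p} {b ∷ p′} q e =
    ⊕-cong (scale-cong (coeff≈ e 0) (≋-refl {q})) (∷-cong refl (⊗-congʳ q (∷-injectiveʳ e)))

  ⊗-cong : ∀ {p p′ q q′} → p ≋ p′ → q ≋ q′ → p ⊗ q ≋ p′ ⊗ q′
  ⊗-cong {p} {p′} {q} {q′} e f =
    ≋-trans (⊗-congʳ q e) (≋-trans (⊗-comm p′ q) (≋-trans (⊗-congʳ p′ f) (⊗-comm q′ p′)))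

  ⊗-distribʳ : ∀ q p p′ → (p ⊕ p′) ⊗ q ≋ p ⊗ q ⊕ p′ ⊗ q
  ⊗-distribʳ q []      p′       = ≋-refl
  ⊗-distribʳ q (a ∷ p) []       = ≋-sym (⊕-identityʳ _)
  ⊗-distribʳ q (a ∷ p) (b ∷ p′) =
    ≋-trans (⊕-cong (scale-+ a b q) (≋-trans (∷-cong refl (⊗-distribʳ q p p′)) (shift-⊕ (p ⊗ q) (p′ ⊗ q))))
            (⊕-interchange (scale a q) (scale b q) (0# ∷ p ⊗ q) (0# ∷ p′ ⊗ q))

  ⊗-distribˡ : ∀ q p p′ → q ⊗ (p ⊕ p′) ≋ q ⊗ p ⊕ q ⊗ p′
  ⊗-distribˡ q p p′ = ≋-trans (⊗-comm q (p ⊕ p′))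
    (≋-trans (⊗-distribʳ q p p′) (⊕-cong (⊗-comm p q) (⊗-comm p′ q)))

  shift-⊗ : ∀ p q → (0# ∷ p) ⊗ q ≋ 0# ∷ p ⊗ q
  shift-⊗ p q = ⊕-cong {q = 0# ∷ p ⊗ q} (scale-zero q refl) ≋-refl

  scale-⊗ : ∀ a p q → scale a p ⊗ q ≋ scale a (p ⊗ q)
  scale-⊗ a []      q = ≋-refl
  scale-⊗ a (b ∷ p) q =
    ≋-trans (⊕-cong (scale-* a b q) (∷-cong (sym (zeroʳ a)) (scale-⊗ a p q)))
            (≋-sym (scale-⊕ a (scale b q) (0# ∷ p ⊗ q)))

  ⊗-assoc : ∀ p q r → (p ⊗ q) ⊗ r ≋ p ⊗ (q ⊗ r)
  ⊗-assoc []      q r = ≋-refl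
  ⊗-assoc (a ∷ p) q r =
    ≋-trans (⊗-distribʳ r (scale a q) (0# ∷ p ⊗ q))
    (⊕-cong (scale-⊗ a q r) (≋-trans (shift-⊗ (p ⊗ q) r) (∷-cong refl (⊗-assoc p q r))))

  const-⊗ : ∀ a p → const a ⊗ p ≋ scale a p
  const-⊗ a p = ≋-trans (⊕-cong (≋-refl {scale a p}) (∷-zero {p = []} refl ≋-refl)) (⊕-identityʳ _)

  ⊗-identityˡ : ∀ p → const 1# ⊗ p ≋ p
  ⊗-identityˡ p = ≋-trans (const-⊗ 1# p) (scale-one p)

  ⊗-identityʳ : ∀ p → p ⊗ const 1# ≋ p
  ⊗-identityʳ p = ≋-trans (⊗-comm p _) (⊗-identityˡ p)

  polynomialRing : CommutativeRing c ℓ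
  polynomialRing = record
    { Carrier = Poly ; _≈_ = _≋_ ; _+_ = _⊕_ ; _*_ = _⊗_ ; -_ = neg ; 0# = [] ; 1# = const 1#
    ; isCommutativeRing = record
      { isRing = record
        { +-isAbelianGroup = record
          { isGroup = record
            { isMonoid = record
              { isSemigroup = record
                { isMagma = record { isEquivalence = Setoid.isEquivalence ≋-setoid ; ∙-cong = ⊕-cong }
                ; assoc = ⊕-assoc }
              ; identity = (λ _ → ≋-refl) , ⊕-identityʳ }
            ; inverse = neg-inverseˡ , neg-inverseʳ
            ; ⁻¹-cong = neg-cong }
          ; comm = ⊕-comm }
        ; *-cong = ⊗-cong
        ; *-assoc = ⊗-assoc
        ; *-identity = ⊗-identityˡ , ⊗-identityʳ
        ; distrib = ⊗-distribˡ , ⊗-distribʳ }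
      ; *-comm = ⊗-comm } }

open Polynomial using (Poly; polynomialRing; const; X)

-- ∑ᵢ aᵢ Xⁱ ↦ ∑ᵢ h(aᵢ) xⁱ, by Horner's rule.
module Evaluation (R : CommutativeRing c ℓ) (S : CommutativeRing c′ ℓ′) where

  private
    module R = CommutativeRing R
    module S = CommutativeRing S
    module P = CommutativeRing (polynomialRing R)
    open Polynomial R using (mk≋; coeff≈; scale; ∷-injectiveʳ; ∷-zero⁻)
    open RingMorphisms

  evalVia : (R.Carrier → S.Carrier) → S.Carrier → Poly R → S.Carrier
  evalVia h x []      = S.0#
  evalVia h x (a ∷ p) = h a S.+ x S.* evalVia h x p

  module _ {h : R.Carrier → S.Carrier} (isHom : IsRingHomomorphism R.rawRing S.rawRing h) (x : S.Carrier) where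

    open IsRingHomomorphism isHom
    open S using (_+_; _*_; 0#; 1#; +-cong; +-congˡ; +-congʳ; *-congˡ; *-cong)
    open import Relation.Binary.Reasoning.Setoid S.setoid
    open import Algebra.Properties.CommutativeSemigroup S.+-commutativeSemigroup using (interchange)
    open import Algebra.Properties.CommutativeSemigroup S.*-commutativeSemigroup using () renaming (x∙yz≈y∙xz to *-swap)
    open import Algebra.Properties.Ring S.ring using (-0#≈0#; -‿+-comm; -‿distribʳ-*)

    private
      ev : Poly R → S.Carrier
      ev = evalVia h x

    ev-zero : ∀ p → p P.≈ [] → ev p S.≈ 0#
    ev-zero []      e = S.refl
    ev-zero (a ∷ p) e = begin
      h a + x * ev p   ≈⟨ +-cong (S.trans (⟦⟧-cong (coeff≈ e 0)) 0#-homo) (*-congˡ (ev-zero p (∷-zero⁻ e))) ⟩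
      0# + x * 0#      ≈⟨ S.trans (S.+-identityˡ _) (S.zeroʳ x) ⟩
      0#               ∎

    ev-cong : ∀ {p q} → p P.≈ q → ev p S.≈ ev q
    ev-cong {[]}    {q}     e = S.sym (ev-zero q (P.sym e))
    ev-cong {a ∷ p} {[]}    e = ev-zero (a ∷ p) e
    ev-cong {a ∷ p} {b ∷ q} e = +-cong (⟦⟧-cong (coeff≈ e 0)) (*-congˡ (ev-cong (∷-injectiveʳ e)))

    ev-+ : ∀ p q → ev (p P.+ q) S.≈ ev p + ev q
    ev-+ []      q       = S.sym (S.+-identityˡ _)
    ev-+ (a ∷ p) []      = S.sym (S.+-identityʳ _)
    ev-+ (a ∷ p) (b ∷ q) = begin
      h (a R.+ b) + x * ev (p P.+ q)         ≈⟨ +-cong (+-homo a b) (*-congˡ (ev-+ p q)) ⟩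
      (h a + h b) + x * (ev p + ev q)        ≈⟨ +-congˡ (S.distribˡ x _ _) ⟩
      (h a + h b) + (x * ev p + x * ev q)    ≈⟨ interchange _ _ _ _ ⟩
      (h a + x * ev p) + (h b + x * ev q)    ∎

    ev-scale : ∀ a p → ev (scale a p) S.≈ h a * ev p
    ev-scale a []      = S.sym (S.zeroʳ _)
    ev-scale a (b ∷ p) = begin
      h (a R.* b) + x * ev (scale a p)  ≈⟨ +-cong (*-homo a b) (*-congˡ (ev-scale a p)) ⟩
      h a * h b + x * (h a * ev p)      ≈⟨ +-congˡ (*-swap _ _ _) ⟩
      h a * h b + h a * (x * ev p)      ≈⟨ S.distribˡ _ _ _ ⟨
      h a * (h b + x * ev p)            ∎

    ev-* : ∀ p q → ev (p P.* q) S.≈ ev p * ev q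
    ev-* []      q = S.sym (S.zeroˡ _)
    ev-* (a ∷ p) q = begin
      ev (scale a q P.+ (R.0# ∷ p P.* q))        ≈⟨ ev-+ (scale a q) (R.0# ∷ p P.* q) ⟩
      ev (scale a q) + (h R.0# + x * ev (p P.* q)) ≈⟨ +-cong (ev-scale a q) (S.trans (+-congʳ 0#-homo) (S.+-identityˡ _)) ⟩
      h a * ev q + x * ev (p P.* q)              ≈⟨ +-congˡ (S.trans (*-congˡ (ev-* p q)) (S.sym (S.*-assoc _ _ _))) ⟩
      h a * ev q + (x * ev p) * ev q             ≈⟨ S.distribʳ _ _ _ ⟨
      (h a + x * ev p) * ev q                    ∎

    ev-neg : ∀ p → ev (P.- p) S.≈ S.- ev p
    ev-neg []      = S.sym -0#≈0#
    ev-neg (a ∷ p) = begin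
      h (R.- a) + x * ev (P.- p)     ≈⟨ +-cong (-‿homo a) (*-congˡ (ev-neg p)) ⟩
      S.- h a + x * (S.- ev p)       ≈⟨ +-congˡ (-‿distribʳ-* x _) ⟨
      S.- h a + S.- (x * ev p)       ≈⟨ -‿+-comm _ _ ⟩
      S.- (h a + x * ev p)           ∎

    ev-const : ∀ a → ev (const R a) S.≈ h a
    ev-const a = S.trans (+-congˡ (S.zeroʳ x)) (S.+-identityʳ _)

    ev-X : ev (X R) S.≈ x
    ev-X = begin
      h R.0# + x * ev (const R R.1#)  ≈⟨ +-cong 0#-homo (*-congˡ (S.trans (ev-const R.1#) 1#-homo)) ⟩
      0# + x * 1#                     ≈⟨ S.trans (S.+-identityˡ _) (S.*-identityʳ x) ⟩
      x                               ∎

    evalVia-isRingHomomorphism : IsRingHomomorphism P.rawRing S.rawRing ev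
    evalVia-isRingHomomorphism = record
      { isSemiringHomomorphism = record
        { isNearSemiringHomomorphism = record
          { +-isMonoidHomomorphism = record
            { isMagmaHomomorphism = record
              { isRelHomomorphism = record { cong = ev-cong } ; homo = ev-+ }
            ; ε-homo = S.refl }
          ; *-homo = ev-* }
        ; 1#-homo = S.trans (ev-const R.1#) 1#-homo }
      ; -‿homo = ev-neg }

open Evaluation using (evalVia)

eval : (R : CommutativeRing c ℓ) → Poly R → CommutativeRing.Carrier R → CommutativeRing.Carrier R
eval R p x = evalVia R R id x p

module _ (R : CommutativeRing c ℓ) where

  private
    module R = CommutativeRing R
    module P = CommutativeRing (polynomialRing R)
    open Polynomial R using (mk≋; ∷-cong; ∷-zero; ≋-refl; const-⊗; ≋-sym)
    open RingMorphisms

  const-isRingHomomorphism : IsRingHomomorphism R.rawRing P.rawRing (const R)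
  const-isRingHomomorphism = record
    { isSemiringHomomorphism = record
      { isNearSemiringHomomorphism = record
        { +-isMonoidHomomorphism = record
          { isMagmaHomomorphism = record
            { isRelHomomorphism = record { cong = λ e → ∷-cong e ≋-refl } ; homo = λ _ _ → ≋-refl }
          ; ε-homo = ∷-zero R.refl ≋-refl }
        ; *-homo = λ a b → ≋-sym (const-⊗ a (const R b)) }
      ; 1#-homo = ≋-refl }
    ; -‿homo = λ _ → ≋-refl }

record IntegralDomain c ℓ : Set (lsuc (c ⊔ ℓ)) where
  field
    commutativeRing : CommutativeRing c ℓ
  open CommutativeRing commutativeRing public
  field
    1≉0             : ¬ 1# ≈ 0#
    noZeroDivisors  : ∀ x y → x * y ≈ 0# → x ≈ 0# ⊎ y ≈ 0#

module Fractions (D : IntegralDomain c ℓ) where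

  open IntegralDomain D
  open import Algebra.Properties.Ring ring using (-‿distribˡ-*; x[y-z]≈xy-xz)
  open import Algebra.Properties.Group +-group using (x∙y⁻¹≈ε⇒x≈y; x≈y⇒x∙y⁻¹≈ε)
  open import Algebra.Solver.Ring.NaturalCoefficients.Default commutativeSemiring
    using (solve; _:=_; _:+_; _:*_; con)
  open import Relation.Binary.Reasoning.Setoid setoid

  infix 5 _/_[_]

  record Frac : Set (c ⊔ ℓ) where
    constructor _/_[_]
    field
      num   : Carrier
      den   : Carrier
      den≉0 : ¬ den ≈ 0#

  open Frac public

  infix 4 _≃_

  record _≃_ (x y : Frac) : Set ℓ where
    constructor mk≃
    field
      cross≈ : num x * den y ≈ num y * den x

  open _≃_ public

  *-≉0 : ∀ {x y} → ¬ x ≈ 0# → ¬ y ≈ 0# → ¬ x * y ≈ 0#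
  *-≉0 {x} {y} x≉0 y≉0 e with noZeroDivisors x y e
  ... | inj₁ x≈0 = x≉0 x≈0
  ... | inj₂ y≈0 = y≉0 y≈0

  *-cancelˡ : ∀ x {y z} → ¬ x ≈ 0# → x * y ≈ x * z → y ≈ z
  *-cancelˡ x {y} {z} x≉0 e
    with noZeroDivisors x (y - z) (trans (x[y-z]≈xy-xz x y z) (x≈y⇒x∙y⁻¹≈ε e))
  ... | inj₁ x≈0   = ⊥-elim (x≉0 x≈0)
  ... | inj₂ y-z≈0 = x∙y⁻¹≈ε⇒x≈y y z y-z≈0

  ≃-trans : ∀ {x y z} → x ≃ y → y ≃ z → x ≃ z
  ≃-trans {a / b [ _ ]} {a′ / b′ [ b′≉0 ]} {a″ / b″ [ _ ]} (mk≃ e) (mk≃ f) =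
    mk≃ (*-cancelˡ b′ b′≉0 (begin
      b′ * (a * b″)    ≈⟨ solve 3 (λ x y z → x :* (y :* z) := (y :* x) :* z) refl b′ a b″ ⟩
      (a * b′) * b″    ≈⟨ *-congʳ e ⟩
      (a′ * b) * b″    ≈⟨ solve 3 (λ x y z → (x :* y) :* z := (x :* z) :* y) refl a′ b b″ ⟩
      (a′ * b″) * b    ≈⟨ *-congʳ f ⟩
      (a″ * b′) * b    ≈⟨ solve 3 (λ x y z → (x :* y) :* z := y :* (x :* z)) refl a″ b′ b ⟩
      b′ * (a″ * b)    ∎))

  fromDomain : Carrier → Frac
  fromDomain a = a / 1# [ 1≉0 ]

  _⊞_ : Frac → Frac → Frac
  (a / b [ b≉0 ]) ⊞ (a′ / b′ [ b′≉0 ]) = (a * b′ + a′ * b) / b * b′ [ *-≉0 b≉0 b′≉0 ]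

  _⊠_ : Frac → Frac → Frac
  (a / b [ b≉0 ]) ⊠ (a′ / b′ [ b′≉0 ]) = (a * a′) / b * b′ [ *-≉0 b≉0 b′≉0 ]

  ⊟_ : Frac → Frac
  ⊟ (a / b [ b≉0 ]) = (- a) / b [ b≉0 ]

  ⊞-cong : ∀ {x x′ y y′} → x ≃ x′ → y ≃ y′ → (x ⊞ y) ≃ (x′ ⊞ y′)
  ⊞-cong {a / b [ _ ]} {a′ / b′ [ _ ]} {p / q [ _ ]} {p′ / q′ [ _ ]} (mk≃ e) (mk≃ f) = mk≃ (begin
    (a * q + p * b) * (b′ * q′)
      ≈⟨ solve 6 (λ a b p q b′ q′ → (a :* q :+ p :* b) :* (b′ :* q′)
           := (a :* b′) :* (q :* q′) :+ (p :* q′) :* (b :* b′)) refl a b p q b′ q′ ⟩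
    (a * b′) * (q * q′) + (p * q′) * (b * b′)
      ≈⟨ +-cong (*-congʳ e) (*-congʳ f) ⟩
    (a′ * b) * (q * q′) + (p′ * q) * (b * b′)
      ≈⟨ solve 6 (λ a′ b p′ q b′ q′ → (a′ :* b) :* (q :* q′) :+ (p′ :* q) :* (b :* b′)
           := (a′ :* q′ :+ p′ :* b′) :* (b :* q)) refl a′ b p′ q b′ q′ ⟩
    (a′ * q′ + p′ * b′) * (b * q) ∎)

  ⊠-cong : ∀ {x x′ y y′} → x ≃ x′ → y ≃ y′ → (x ⊠ y) ≃ (x′ ⊠ y′)
  ⊠-cong {a / b [ _ ]} {a′ / b′ [ _ ]} {p / q [ _ ]} {p′ / q′ [ _ ]} (mk≃ e) (mk≃ f) = mk≃ (begin
    (a * p) * (b′ * q′)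
      ≈⟨ solve 4 (λ a p b′ q′ → (a :* p) :* (b′ :* q′) := (a :* b′) :* (p :* q′)) refl a p b′ q′ ⟩
    (a * b′) * (p * q′)   ≈⟨ *-cong e f ⟩
    (a′ * b) * (p′ * q)
      ≈⟨ solve 4 (λ a p b′ q′ → (a :* b′) :* (p :* q′) := (a :* p) :* (b′ :* q′)) refl a′ p′ b q ⟩
    (a′ * p′) * (b * q)   ∎)

  ⊟-cong : ∀ {x y} → x ≃ y → (⊟ x) ≃ (⊟ y)
  ⊟-cong {a / b [ _ ]} {a′ / b′ [ _ ]} (mk≃ e) = mk≃ (begin
    (- a) * b′     ≈⟨ -‿distribˡ-* a b′ ⟨
    - (a * b′)     ≈⟨ -‿cong e ⟩
    - (a′ * b)     ≈⟨ -‿distribˡ-* a′ b ⟩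
    (- a′) * b     ∎)

  ⊞-comm : ∀ x y → (x ⊞ y) ≃ (y ⊞ x)
  ⊞-comm (a / b [ _ ]) (p / q [ _ ]) = mk≃
    (solve 4 (λ a b p q → (a :* q :+ p :* b) :* (q :* b) := (p :* b :+ a :* q) :* (b :* q)) refl a b p q)

  ⊞-assoc : ∀ x y z → ((x ⊞ y) ⊞ z) ≃ (x ⊞ (y ⊞ z))
  ⊞-assoc (a / b [ _ ]) (p / q [ _ ]) (u / v [ _ ]) = mk≃
    (solve 6 (λ a b p q u v →
        ((a :* q :+ p :* b) :* v :+ u :* (b :* q)) :* (b :* (q :* v))
        := (a :* (q :* v) :+ (p :* v :+ u :* q) :* b) :* ((b :* q) :* v)) refl a b p q u v)

  ⊞-identityʳ : ∀ x → (x ⊞ fromDomain 0#) ≃ x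
  ⊞-identityʳ (a / b [ _ ]) = mk≃
    (solve 2 (λ a b → (a :* con 1 :+ con 0 :* b) :* b := a :* (b :* con 1)) refl a b)

  ⊟-inverseˡ : ∀ x → ((⊟ x) ⊞ x) ≃ fromDomain 0#
  ⊟-inverseˡ (a / b [ _ ]) = mk≃ (begin
    ((- a) * b + a * b) * 1#   ≈⟨ *-identityʳ _ ⟩
    (- a) * b + a * b          ≈⟨ distribʳ b (- a) a ⟨
    (- a + a) * b              ≈⟨ trans (*-congʳ (-‿inverseˡ a)) (zeroˡ b) ⟩
    0#                         ≈⟨ zeroˡ _ ⟨
    0# * (b * b)               ∎)

  ⊠-comm : ∀ x y → (x ⊠ y) ≃ (y ⊠ x)
  ⊠-comm (a / b [ _ ]) (p / q [ _ ]) = mk≃ (*-cong (*-comm a p) (*-comm q b))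

  ⊠-assoc : ∀ x y z → ((x ⊠ y) ⊠ z) ≃ (x ⊠ (y ⊠ z))
  ⊠-assoc (a / b [ _ ]) (p / q [ _ ]) (u / v [ _ ]) = mk≃ (*-cong (*-assoc a p u) (sym (*-assoc b q v)))

  ⊠-identityˡ : ∀ x → (fromDomain 1# ⊠ x) ≃ x
  ⊠-identityˡ (a / b [ _ ]) = mk≃
    (solve 2 (λ a b → (con 1 :* a) :* b := a :* (con 1 :* b)) refl a b)

  ⊠-distribˡ : ∀ x y z → (x ⊠ (y ⊞ z)) ≃ ((x ⊠ y) ⊞ (x ⊠ z))
  ⊠-distribˡ (a / b [ _ ]) (p / q [ _ ]) (u / v [ _ ]) = mk≃
    (solve 6 (λ a b p q u v →
        (a :* (p :* v :+ u :* q)) :* ((b :* q) :* (b :* v))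
        := ((a :* p) :* (b :* v) :+ (a :* u) :* (b :* q)) :* (b :* (q :* v))) refl a b p q u v)

  fractionField : CommutativeRing (c ⊔ ℓ) ℓ
  fractionField = record
    { Carrier = Frac ; _≈_ = _≃_ ; _+_ = _⊞_ ; _*_ = _⊠_ ; -_ = ⊟_ ; 0# = fromDomain 0# ; 1# = fromDomain 1#
    ; isCommutativeRing = record
      { isRing = record
        { +-isAbelianGroup = record
          { isGroup = record
            { isMonoid = record
              { isSemigroup = record
                { isMagma = record
                  { isEquivalence = record
                    { refl = mk≃ refl ; sym = λ e → mk≃ (sym (cross≈ e)) ; trans = ≃-trans }
                  ; ∙-cong = ⊞-cong }
                ; assoc = ⊞-assoc }
              ; identity = (λ x → ≃-trans (⊞-comm (fromDomain 0#) x) (⊞-identityʳ x)) , ⊞-identityʳ }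
            ; inverse = ⊟-inverseˡ , λ x → ≃-trans (⊞-comm x (⊟ x)) (⊟-inverseˡ x)
            ; ⁻¹-cong = ⊟-cong }
          ; comm = ⊞-comm }
        ; *-cong = ⊠-cong
        ; *-assoc = ⊠-assoc
        ; *-identity = ⊠-identityˡ , λ x → ≃-trans (⊠-comm x (fromDomain 1#)) (⊠-identityˡ x)
        ; distrib = ⊠-distribˡ , λ x y z →
            ≃-trans (⊠-comm (y ⊞ z) x) (≃-trans (⊠-distribˡ x y z) (⊞-cong (⊠-comm x y) (⊠-comm x z))) }
      ; *-comm = ⊠-comm } }

record Field c ℓ : Set (lsuc (c ⊔ ℓ)) where
  field
    commutativeRing : CommutativeRing c ℓ
  open CommutativeRing commutativeRing public
  field
    1≉0     : ¬ 1# ≈ 0#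
    inverse : ∀ x → ¬ x ≈ 0# → ∃ λ y → y * x ≈ 1#

record FiniteField c ℓ (q : ℕ) : Set (lsuc (c ⊔ ℓ)) where
  field
    underlyingField : Field c ℓ
  open Field underlyingField public
  field
    enumeration : Inverse (≡.setoid (Fin q)) setoid

IsPrimePower : ℕ → Set
IsPrimePower q = ∃₂ λ p n → Prime p × 1 ℕ.≤ n × q ≡ p ℕ.^ n

module FunctionField {q : ℕ} (F : FiniteField c ℓ q) where

  module F where
    open FiniteField F public
    open Inverse enumeration public using (to; from; to-cong; from-cong; inverseˡ; inverseʳ)

  𝔸 : CommutativeRing c ℓ
  𝔸 = polynomialRing F.commutativeRing

  module A where
    open CommutativeRing 𝔸 public
    open Polynomial F.commutativeRing public
      using (coeff; coeff≈; mk≋; scale; coeff-⊕; coeff-neg; coeff-scale; ∷-cong; ∷-injectiveʳ;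
             ∷-zero; ∷-zero⁻; ⊗-∷; const-⊗; shift-⊗; shift-⊕)
    open import Algebra.Properties.CommutativeSemigroup.Divisibility *-commutativeSemigroup public

  θ : A.Carrier
  θ = X F.commutativeRing

  _≟F_ : Decidable F._≈_
  x ≟F y = map′ (λ e → F.trans (F.sym (F.inverseˡ ≡.refl)) (F.inverseˡ e)) F.from-cong (F.from x Fin.≟ F.from y)

  ≈0? : ∀ p → Dec (p A.≈ A.0#)
  ≈0? []      = yes A.refl
  ≈0? (a ∷ p) with a ≟F F.0# | ≈0? p
  ... | yes a≈0 | yes p≈0 = yes (A.∷-zero a≈0 p≈0)
  ... | no  a≉0 | _       = no λ e → a≉0 (A.coeff≈ e 0)
  ... | _       | no  p≉0 = no λ e → p≉0 (A.∷-zero⁻ e)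

  open import Algebra.Definitions.RawMagma A.*-rawMagma using (_,_)
  open import Algebra.Properties.Group A.+-group using (x∙y⁻¹≈ε⇒x≈y; x≈y⇒x∙y⁻¹≈ε)

  _≟_ : Decidable A._≈_
  p ≟ p′ = map′ (x∙y⁻¹≈ε⇒x≈y p p′) x≈y⇒x∙y⁻¹≈ε (≈0? (p A.- p′))

  F-noZeroDivisors : ∀ x y → x F.* y F.≈ F.0# → x F.≈ F.0# ⊎ y F.≈ F.0#
  F-noZeroDivisors x y xy≈0 with x ≟F F.0#
  ... | yes x≈0 = inj₁ x≈0
  ... | no  x≉0 = let x⁻¹ , x⁻¹x≈1 = F.inverse x x≉0 in inj₂ (begin
    y                    ≈⟨ F.*-identityˡ y ⟨
    F.1# F.* y           ≈⟨ F.*-congʳ x⁻¹x≈1 ⟨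
    (x⁻¹ F.* x) F.* y    ≈⟨ F.*-assoc x⁻¹ x y ⟩
    x⁻¹ F.* (x F.* y)    ≈⟨ F.*-congˡ xy≈0 ⟩
    x⁻¹ F.* F.0#         ≈⟨ F.zeroʳ x⁻¹ ⟩
    F.0#                 ∎)
    where open import Relation.Binary.Reasoning.Setoid F.setoid

  private
    step : ∀ a p b r → Dec (a F.≈ F.0#) → Dec (b F.≈ F.0#) →
           (p A.* (b ∷ r) A.≈ A.0# → p A.≈ A.0# ⊎ (b ∷ r) A.≈ A.0#) →
           ((a ∷ p) A.* r A.≈ A.0# → (a ∷ p) A.≈ A.0# ⊎ r A.≈ A.0#) →
           (a ∷ p) A.* (b ∷ r) A.≈ A.0# → (a ∷ p) A.≈ A.0# ⊎ (b ∷ r) A.≈ A.0#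
    step a p b r (yes a≈0) _ rec _ e with rec (A.∷-zero⁻ (A.trans (A.sym (A.shift-⊗ p (b ∷ r)))
        (A.trans (A.*-congʳ {b ∷ r} {F.0# ∷ p} {a ∷ p} (A.∷-cong (F.sym a≈0) A.refl)) e)))
    ... | inj₁ p≈0  = inj₁ (A.∷-zero a≈0 p≈0)
    ... | inj₂ br≈0 = inj₂ br≈0
    step a p b r (no _) (yes b≈0) _ rec e with rec (A.∷-zero⁻ (A.trans (A.sym shifted)
        (A.trans (A.*-congˡ {a ∷ p} {F.0# ∷ r} {b ∷ r} (A.∷-cong (F.sym b≈0) A.refl)) e)))
      where
      shifted : (a ∷ p) A.* (F.0# ∷ r) A.≈ F.0# ∷ (a ∷ p) A.* r
      shifted = A.trans (A.*-comm (a ∷ p) (F.0# ∷ r))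
                (A.trans (A.shift-⊗ r (a ∷ p)) (A.∷-cong F.refl (A.*-comm r (a ∷ p))))
    ... | inj₁ ap≈0 = inj₁ ap≈0
    ... | inj₂ r≈0  = inj₂ (A.∷-zero b≈0 r≈0)
    step a p b r (no a≉0) (no b≉0) _ _ e
      with F-noZeroDivisors a b (F.trans (F.sym (F.+-identityʳ _)) (A.coeff≈ e 0))
    ... | inj₁ a≈0 = ⊥-elim (a≉0 a≈0)
    ... | inj₂ b≈0 = ⊥-elim (b≉0 b≈0)

  A-noZeroDivisors : ∀ x y → x A.* y A.≈ A.0# → x A.≈ A.0# ⊎ y A.≈ A.0#
  A-noZeroDivisors []      y       e = inj₁ A.refl
  A-noZeroDivisors (a ∷ p) []      e = inj₂ A.refl
  A-noZeroDivisors (a ∷ p) (b ∷ r) e = step a p b r (a ≟F F.0#) (b ≟F F.0#)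
    (A-noZeroDivisors p (b ∷ r)) (A-noZeroDivisors (a ∷ p) r) e

  A-integralDomain : IntegralDomain c ℓ
  A-integralDomain = record
    { commutativeRing = 𝔸
    ; 1≉0 = λ e → F.1≉0 (A.coeff≈ e 0)
    ; noZeroDivisors = A-noZeroDivisors }

  open Fractions A-integralDomain public using (Frac; _/_[_]; fromDomain; fractionField; *-≉0; *-cancelˡ)

  𝕂 : CommutativeRing (c ⊔ ℓ) ℓ
  𝕂 = fractionField

  module K = CommutativeRing 𝕂

  𝔸[t] : CommutativeRing c ℓ
  𝔸[t] = polynomialRing 𝔸

  module A[t] = CommutativeRing 𝔸[t]

  𝔸[t][z] : CommutativeRing c ℓ
  𝔸[t][z] = polynomialRing 𝔸[t]

  module A[t][z] = CommutativeRing 𝔸[t][z]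

  𝕂[t] : CommutativeRing (c ⊔ ℓ) ℓ
  𝕂[t] = polynomialRing 𝕂

  module K[t] where
    open CommutativeRing 𝕂[t] public
    open import Algebra.Properties.Semiring.Exp semiring public using (_^_)

  constK : K.Carrier → K[t].Carrier
  constK = const 𝕂

  -- The inclusion A[t] ⊂ K[t], coefficientwise.
  ι : A[t].Carrier → K[t].Carrier
  ι = map fromDomain

  HasDegree : ℕ → A.Carrier → Set ℓ
  HasDegree d p = ¬ A.coeff p d F.≈ F.0# × (∀ n → d ℕ.< n → A.coeff p n F.≈ F.0#)

  IsMonic : ℕ → A.Carrier → Set ℓ
  IsMonic d p = A.coeff p d F.≈ F.1# × (∀ n → d ℕ.< n → A.coeff p n F.≈ F.0#)

  IsMonic⇒≉0 : ∀ {d p} → IsMonic d p → ¬ p A.≈ A.0#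
  IsMonic⇒≉0 {d} (lead≈1 , _) p≈0 = F.1≉0 (F.trans (F.sym lead≈1) (A.coeff≈ p≈0 d))

  IsMonic⇒HasDegree : ∀ {d p} → IsMonic d p → HasDegree d p
  IsMonic⇒HasDegree (lead≈1 , above) = (λ e → F.1≉0 (F.trans (F.sym lead≈1) e)) , above

  record A₊ (d : ℕ) : Set (c ⊔ ℓ) where
    constructor mkA₊
    field
      poly  : A.Carrier
      monic : IsMonic d poly

    poly≉0 : ¬ poly A.≈ A.0#
    poly≉0 = IsMonic⇒≉0 {p = poly} monic

  open A₊ public

  A₊-setoid : ℕ → Setoid (c ⊔ ℓ) ℓ
  A₊-setoid d = record
    { Carrier = A₊ d ; _≈_ = λ a b → poly a A.≈ poly b
    ; isEquivalence = record { refl = A.refl ; sym = A.sym ; trans = A.trans } }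

  F-elements : List F.Carrier
  F-elements = map F.to (allFin q)

  -- c + θ a: coefficient lists start with the constant term.
  extend : ∀ {d} → F.Carrier → A₊ d → A₊ (suc d)
  extend {d} c a = mkA₊ (c ∷ poly a) (proj₁ (monic a) , λ { (suc n) (s≤s d<n) → proj₂ (monic a) n d<n })

  -- The elements of A₊(d), each listed exactly once: see ∈-monics and monics-unique.
  monics : ∀ d → List (A₊ d)
  monics zero    = mkA₊ A.1# (F.refl , λ { (suc n) _ → F.refl }) ∷ []
  monics (suc d) = cartesianProductWith extend F-elements (monics d)

  private
    module ∈F = SetoidMembership F.setoid
    module ∈A₊ (d : ℕ) = SetoidMembership (A₊-setoid d)

  ∈-F-elements : ∀ x → x ∈F.∈ F-elements
  ∈-F-elements x = SetoidMembershipₚ.∈-resp-≈ F.setoid (F.inverseˡ ≡.refl)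
    (SetoidMembershipₚ.∈-map⁺ (≡.setoid (Fin q)) F.setoid F.to-cong (Membershipₚ.∈-allFin (F.from x)))

  F-elements-unique : SetoidUnique.Unique F.setoid F-elements
  F-elements-unique = SetoidUniqueₚ.map⁺ (≡.setoid (Fin q)) F.setoid
    (λ {x} {y} e → ≡.trans (≡.sym (F.inverseʳ {x} F.refl)) (F.inverseʳ {y} e)) (Uniqueₚ.allFin⁺ q)

  ∈-monics : ∀ {d} (a : A₊ d) → ∈A₊._∈_ d a (monics d)
  ∈-monics {zero} (mkA₊ p (lead≈1 , above)) =
    here (A.mk≋ λ { zero → lead≈1 ; (suc n) → above (suc n) (s≤s z≤n) })
  ∈-monics {suc d} (mkA₊ []      (lead≈1 , above)) = ⊥-elim (F.1≉0 (F.sym lead≈1))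
  ∈-monics {suc d} (mkA₊ (x ∷ p) (lead≈1 , above)) =
    SetoidMembershipₚ.∈-cartesianProductWith⁺ F.setoid (A₊-setoid d) (A₊-setoid (suc d)) {f = extend} A.∷-cong
      {a = x} {b = tail} (∈-F-elements x) (∈-monics tail)
    where
    tail : A₊ d
    tail = mkA₊ p (lead≈1 , λ n d<n → above (suc n) (s≤s d<n))

  monics-unique : ∀ d → SetoidUnique.Unique (A₊-setoid d) (monics d)
  monics-unique zero    = [] ∷ []
  monics-unique (suc d) = SetoidUniqueₚ.cartesianProductWith⁺ F.setoid (A₊-setoid d) (A₊-setoid (suc d)) extend
    (λ e → A.coeff≈ e 0 , A.∷-injectiveʳ e) F-elements-unique (monics-unique d)

  D : ℕ → A.Carrier
  D d = ∏ 𝔸 (monics d) poly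

  D≉0 : ∀ d → ¬ D d A.≈ A.0#
  D≉0 d = go (monics d)
    where
    go : (as : List (A₊ d)) → ¬ ∏ 𝔸 as poly A.≈ A.0#
    go []       e = F.1≉0 (A.coeff≈ e 0)
    go (a ∷ as) e = *-≉0 {poly a} (poly≉0 a) (go as) e

  IsCommonMultiple : ℕ → A.Carrier → Set (c ⊔ ℓ)
  IsCommonMultiple d m = ∀ f → HasDegree d f → f A.∣ m

  -- Least common multiples are unique up to a unit; we take the monic one.
  record IsMonicLCM (d : ℕ) (m : A.Carrier) : Set (c ⊔ ℓ) where
    field
      isMonic  : ∃ λ n → IsMonic n m
      multiple : IsCommonMultiple d m
      least    : ∀ m′ → IsCommonMultiple d m′ → m A.∣ m′

  private

    DegreeBelow : ℕ → A.Carrier → Set ℓ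
    DegreeBelow d p = ∀ n → d ℕ.≤ n → A.coeff p n F.≈ F.0#

    degree : ∀ p → p A.≈ A.0# ⊎ ∃ λ d → HasDegree d p
    degree []      = inj₁ A.refl
    degree (a ∷ p) with degree p | a ≟F F.0#
    ... | inj₂ (d , lead≉0 , above) | _ = inj₂ (suc d , lead≉0 , λ { (suc n) (s≤s d<n) → above n d<n })
    ... | inj₁ p≈0 | yes a≈0 = inj₁ (A.∷-zero a≈0 p≈0)
    ... | inj₁ p≈0 | no  a≉0 = inj₂ (0 , a≉0 , λ { (suc n) _ → A.coeff≈ p≈0 n })

    normalise : ∀ {d} f → HasDegree d f → ∃ λ u → IsMonic d (const F.commutativeRing u A.* f)
    normalise {d} f (lead≉0 , above) = u ,
      F.trans (A.coeff≈ (A.const-⊗ u f) d) (F.trans (A.coeff-scale u f d) u*lead≈1) ,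
      λ n d<n → F.trans (A.coeff≈ (A.const-⊗ u f) n)
        (F.trans (A.coeff-scale u f n) (F.trans (F.*-congˡ (above n d<n)) (F.zeroʳ u)))
      where
      u : F.Carrier
      u = proj₁ (F.inverse (A.coeff f d) lead≉0)
      u*lead≈1 : u F.* A.coeff f d F.≈ F.1#
      u*lead≈1 = proj₂ (F.inverse (A.coeff f d) lead≉0)

    module _ {d} (g : A.Carrier) (g-monic : IsMonic d g) where

      divide : ∀ p → ∃₂ λ s r → (s A.* g) A.+ r A.≈ p × DegreeBelow d r
      divide []      = [] , [] , A.refl , λ _ _ → F.refl
      divide (a ∷ p) with divide p
      ... | s , r , e , r<d = k ∷ s , r′ , eq , r′<d
        where
        k : F.Carrier
        k = A.coeff (a ∷ r) d
        kg : A.Carrier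
        kg = A.scale k g
        r′ : A.Carrier
        r′ = (a ∷ r) A.- kg
        sg : A.Carrier
        sg = F.0# ∷ s A.* g

        open import Relation.Binary.Reasoning.Setoid A.setoid
        eq : (kg A.+ sg) A.+ r′ A.≈ a ∷ p
        eq = begin
          (kg A.+ sg) A.+ ((a ∷ r) A.- kg)    ≈⟨ A.+-cong (A.+-comm kg sg) (A.+-comm (a ∷ r) (A.- kg)) ⟩
          (sg A.+ kg) A.+ (A.- kg A.+ (a ∷ r)) ≈⟨ A.+-assoc sg kg _ ⟩
          sg A.+ (kg A.+ (A.- kg A.+ (a ∷ r))) ≈⟨ A.+-congˡ {sg} (A.+-assoc kg (A.- kg) (a ∷ r)) ⟨
          sg A.+ ((kg A.- kg) A.+ (a ∷ r))     ≈⟨ A.+-congˡ {sg} (A.+-congʳ {a ∷ r} (A.-‿inverseʳ kg)) ⟩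
          sg A.+ (a ∷ r)                       ≈⟨ A.∷-cong (F.+-identityˡ a) e ⟩
          a ∷ p                                ∎

        coeff-r′ : ∀ n → A.coeff r′ n F.≈ A.coeff (a ∷ r) n F.- k F.* A.coeff g n
        coeff-r′ n = F.trans (A.coeff-⊕ (a ∷ r) (A.- kg) n)
          (F.+-congˡ (F.trans (A.coeff-neg kg n) (F.-‿cong (A.coeff-scale k g n))))

        open import Algebra.Properties.Group F.+-group using () renaming (x≈y⇒x∙y⁻¹≈ε to F-x-y≈0)

        r′<d : DegreeBelow d r′
        r′<d n d≤n with ℕ.m≤n⇒m<n∨m≡n d≤n
        ... | inj₂ ≡.refl = F.trans (coeff-r′ d)
              (F-x-y≈0 (F.sym (F.trans (F.*-congˡ (proj₁ g-monic)) (F.*-identityʳ k))))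
        ... | inj₁ (s≤s {n = m} d≤m) = F.trans (coeff-r′ (suc m))
              (F-x-y≈0 (F.trans (r<d m d≤m) (F.sym (F.trans (F.*-congˡ (proj₂ g-monic (suc m) (s≤s d≤m))) (F.zeroʳ k)))))

      multiple-zero : ∀ h → DegreeBelow d (h A.* g) → h A.≈ A.0#
      multiple-zero []      _     = A.refl
      multiple-zero (a ∷ h) below = A.∷-zero a≈0 h≈0
        where
        open import Relation.Binary.Reasoning.Setoid F.setoid
        coeff-eq : ∀ n → A.coeff ((a ∷ h) A.* g) n F.≈ a F.* A.coeff g n F.+ A.coeff (F.0# ∷ h A.* g) n
        coeff-eq n = F.trans (A.coeff-⊕ (A.scale a g) _ n) (F.+-congʳ (A.coeff-scale a g n))
        h≈0 : h A.≈ A.0#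
        h≈0 = multiple-zero h λ n d≤n → begin
          A.coeff (h A.* g) n                                  ≈⟨ F.+-identityˡ _ ⟨
          F.0# F.+ A.coeff (h A.* g) n                         ≈⟨ F.+-congʳ (F.trans (F.*-congˡ (proj₂ g-monic (suc n) (s≤s d≤n))) (F.zeroʳ a)) ⟨
          a F.* A.coeff g (suc n) F.+ A.coeff (h A.* g) n      ≈⟨ coeff-eq (suc n) ⟨
          A.coeff ((a ∷ h) A.* g) (suc n)                      ≈⟨ below (suc n) (ℕ.m≤n⇒m≤1+n d≤n) ⟩
          F.0#                                                 ∎
        hg≈0 : (F.0# ∷ h A.* g) A.≈ A.0#
        hg≈0 = A.∷-zero F.refl (A.trans (A.*-congʳ {g} {h} {A.0#} h≈0) (A.zeroˡ g))
        a≈0 : a F.≈ F.0#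
        a≈0 = begin
          a                                                    ≈⟨ F.trans (F.*-congˡ (proj₁ g-monic)) (F.*-identityʳ a) ⟨
          a F.* A.coeff g d                                    ≈⟨ F.trans (F.+-congˡ (A.coeff≈ hg≈0 d)) (F.+-identityʳ _) ⟨
          a F.* A.coeff g d F.+ A.coeff (F.0# ∷ h A.* g) d     ≈⟨ coeff-eq d ⟨
          A.coeff ((a ∷ h) A.* g) d                            ≈⟨ below d ℕ.≤-refl ⟩
          F.0#                                                 ∎

    open import Algebra.Properties.Ring A.ring using (-‿distribˡ-*; [y-z]x≈yx-zx)

    move : ∀ {x y z} → x A.+ y A.≈ z → y A.≈ z A.- x
    move {x} {y} {z} e = begin
      y                        ≈⟨ A.+-identityʳ y ⟨
      y A.+ A.0#               ≈⟨ A.+-congˡ {y} (A.-‿inverseʳ x) ⟨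
      y A.+ (x A.- x)          ≈⟨ A.+-assoc y x (A.- x) ⟨
      (y A.+ x) A.- x          ≈⟨ A.+-congʳ {A.- x} (A.trans (A.+-comm y x) e) ⟩
      z A.- x                  ∎
      where open import Relation.Binary.Reasoning.Setoid A.setoid

    ∣-minus : ∀ {f x y} → f A.∣ x → f A.∣ y → f A.∣ (x A.- y)
    ∣-minus {f} {x} {y} (s , e) (s′ , e′) =
      (s A.- s′) , A.trans ([y-z]x≈yx-zx f s s′) (A.+-cong e (A.-‿cong e′))

    ∣? : ∀ {d} (a : A₊ d) m → Dec (poly a A.∣ m)
    ∣? a m with divide (poly a) (monic a) m
    ... | s , r , e , r<d with ≈0? r
    ...   | yes r≈0 = yes (s , A.trans (A.sym (A.+-identityʳ _)) (A.trans (A.+-congˡ {s A.* poly a} (A.sym r≈0)) e))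
    ...   | no  r≉0 = no λ (h , ha≈m) → r≉0 (r≈0 h ha≈m)
      where
      r≈0 : ∀ h → h A.* poly a A.≈ m → r A.≈ A.0#
      r≈0 h ha≈m = A.trans (A.sym diff) (A.trans (A.*-congʳ {poly a} {h A.- s} {A.0#} h-s≈0) (A.zeroˡ (poly a)))
        where
        diff : (h A.- s) A.* poly a A.≈ r
        diff = A.trans ([y-z]x≈yx-zx (poly a) h s) (A.trans (A.+-congʳ ha≈m) (A.sym (move e)))
        h-s≈0 : h A.- s A.≈ A.0#
        h-s≈0 = multiple-zero (poly a) (monic a) (h A.- s) λ n d≤n → F.trans (A.coeff≈ diff n) (r<d n d≤n)

    MonicsDivide : ℕ → A.Carrier → Set (c ⊔ ℓ)
    MonicsDivide d m = All (λ a → poly a A.∣ m) (monics d)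

    toMonics : ∀ {d m} → IsCommonMultiple d m → MonicsDivide d m
    toMonics cm = All.universal (λ a → cm (poly a) (IsMonic⇒HasDegree {p = poly a} (monic a))) _

    fromMonics : ∀ {d m} → MonicsDivide d m → IsCommonMultiple d m
    fromMonics {d} {m} ms f f-deg =
      let u , uf-monic = normalise f f-deg
          (a∣m , uf≈a) = All.lookupAny ms (∈-monics (mkA₊ _ uf-monic))
      in A.∣-trans (const F.commutativeRing u , uf≈a) a∣m

    D-multiple : ∀ d → MonicsDivide d (D d)
    D-multiple d = go (monics d)
      where
      go : (as : List (A₊ d)) → All (λ a → poly a A.∣ ∏ 𝔸 as poly) as
      go []       = []
      go (a ∷ as) = (∏ 𝔸 as poly , A.*-comm (∏ 𝔸 as poly) (poly a))
                  ∷ All.map (λ (s , e) → (poly a A.* s) , A.trans (A.*-assoc (poly a) s _) (A.*-congˡ {poly a} e)) (go as)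

    smallest : {P : ℕ → Set (c ⊔ ℓ)} → (∀ n → Dec (P n)) → ∀ {n} → P n →
               ∃ λ m → P m × (∀ k → k ℕ.< m → ¬ P k)
    smallest {P} P? {n} Pn = go n 0 (≡.subst P (≡.sym (ℕ.+-identityʳ n)) Pn) λ _ ()
      where
      go : ∀ fuel m → P (fuel ℕ.+ m) → (∀ k → k ℕ.< m → ¬ P k) → ∃ λ m → P m × (∀ k → k ℕ.< m → ¬ P k)
      go zero       m Pm none = m , Pm , none
      go (suc fuel) m Pm none with P? m
      ... | yes p = m , p , none
      ... | no ¬p = go fuel (suc m) (≡.subst P (≡.sym (ℕ.+-suc fuel m)) Pm) none′
        where
        none′ : ∀ k → k ℕ.< suc m → ¬ P k
        none′ k (s≤s k≤m) with ℕ.m≤n⇒m<n∨m≡n k≤m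
        ... | inj₁ k<m    = none k k<m
        ... | inj₂ ≡.refl = ¬p

    MultipleOfDegree : ℕ → ℕ → Set (c ⊔ ℓ)
    MultipleOfDegree d n = Any (λ a → MonicsDivide d (poly a)) (monics n)

    multipleOfDegree? : ∀ d n → Dec (MultipleOfDegree d n)
    multipleOfDegree? d n = Any.any? (λ a → All.all? (λ b → ∣? b (poly a)) (monics d)) (monics n)

    fromCommonMultiple : ∀ {d n} m → HasDegree n m → MonicsDivide d m → MultipleOfDegree d n
    fromCommonMultiple m m-deg ms =
      let u , um-monic = normalise m m-deg in
      Any.map (λ um≈a → All.map (λ b∣m → A.∣-respʳ um≈a (A.x∣ʳy⇒x∣ʳzy (const F.commutativeRing u) b∣m)) ms)
              (∈-monics (mkA₊ _ um-monic))

  monicLCM : ∀ d → Σ A.Carrier (IsMonicLCM d)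
  monicLCM d with degree (D d)
  ... | inj₁ D≈0 = ⊥-elim (D≉0 d D≈0)
  ... | inj₂ (_ , D-deg) with smallest (multipleOfDegree? d) (fromCommonMultiple (D d) D-deg (D-multiple d))
  ...   | n , hasMultiple , none = poly g , record
    { isMonic = n , monic g ; multiple = fromMonics g-multiple ; least = least }
    where
    g : A₊ n
    g = proj₁ (Any.satisfied hasMultiple)
    g-multiple : MonicsDivide d (poly g)
    g-multiple = proj₂ (Any.satisfied hasMultiple)
    least : ∀ m → IsCommonMultiple d m → poly g A.∣ m
    least m cm with divide (poly g) (monic g) m
    ... | s , r , e , r<n with degree r
    ...   | inj₁ r≈0 = s , A.trans (A.sym (A.+-identityʳ _)) (A.trans (A.+-congˡ {s A.* poly g} (A.sym r≈0)) e)
    ...   | inj₂ (k , r-deg) = ⊥-elim (none k k<n (fromCommonMultiple r r-deg r-multiple))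
      where
      k<n : k ℕ.< n
      k<n = ℕ.≰⇒> λ n≤k → proj₁ r-deg (r<n k n≤k)
      r-multiple : MonicsDivide d r
      r-multiple = toMonics λ f f-deg → A.∣-respʳ (A.sym (move e))
        (∣-minus (cm f f-deg) (A.x∣ʳy⇒x∣ʳzy s (fromMonics g-multiple f f-deg)))

  L : ℕ → A.Carrier
  L d = proj₁ (monicLCM d)

  L-isMonicLCM : ∀ d → IsMonicLCM d (L d)
  L-isMonicLCM d = proj₂ (monicLCM d)

  L≉0 : ∀ d → ¬ L d A.≈ A.0#
  L≉0 d = IsMonic⇒≉0 {p = L d} (proj₂ (IsMonicLCM.isMonic (L-isMonicLCM d)))

  D₀≈1 : D 0 A.≈ A.1#
  D₀≈1 = A.*-identityˡ A.1#

  L₀≈1 : L 0 A.≈ A.1#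
  L₀≈1 = go (IsMonicLCM.isMonic (L-isMonicLCM 0))
    (IsMonicLCM.least (L-isMonicLCM 0) A.1# (fromMonics ((A.1# , A.*-identityˡ A.1#) ∷ [])))
    where
    go : ∀ {m} → (∃ λ n → IsMonic n m) → m A.∣ A.1# → m A.≈ A.1#
    go (zero , lead≈1 , above) _ = A.mk≋ λ { zero → lead≈1 ; (suc n) → above (suc n) (s≤s z≤n) }
    go {m} (suc n , m-monic) (h , hm≈1) = ⊥-elim (F.1≉0 (A.coeff≈ 1≈0 0))
      where
      h≈0 : h A.≈ A.0#
      h≈0 = multiple-zero m m-monic h λ { (suc k) _ → A.coeff≈ hm≈1 (suc k) }
      1≈0 : A.1# A.≈ A.0#
      1≈0 = A.trans (A.sym hm≈1) (A.trans (A.*-congʳ {m} {h} {A.0#} h≈0) (A.zeroˡ m))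

  constF : F.Carrier → A[t].Carrier
  constF x = const 𝔸 (const F.commutativeRing x)

  t : A[t].Carrier
  t = X 𝔸

  χₜ : A.Carrier → A[t].Carrier
  χₜ = evalVia F.commutativeRing 𝔸[t] constF t

  private
    open RingMorphisms

    constF-isRingHomomorphism : IsRingHomomorphism F.rawRing A[t].rawRing constF
    constF-isRingHomomorphism = isRingHomomorphism A[t].trans
      (const-isRingHomomorphism F.commutativeRing) (const-isRingHomomorphism 𝔸)
      where open import Algebra.Morphism.Construct.Composition using (isRingHomomorphism)

  χₜ-isRingHomomorphism : IsRingHomomorphism A.rawRing A[t].rawRing χₜ
  χₜ-isRingHomomorphism =
    Evaluation.evalVia-isRingHomomorphism F.commutativeRing 𝔸[t] constF-isRingHomomorphism t

  χₜ-const : ∀ x → χₜ (const F.commutativeRing x) A[t].≈ constF x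
  χₜ-const = Evaluation.ev-const F.commutativeRing 𝔸[t] constF-isRingHomomorphism t

  χₜ-θ : χₜ θ A[t].≈ t
  χₜ-θ = Evaluation.ev-X F.commutativeRing 𝔸[t] constF-isRingHomomorphism t

  monicsExcept : ∀ {d} → A₊ d → List (A₊ d)
  monicsExcept {d} b = filter (λ a → ¬? (poly a ≟ poly b)) (monics d)

  M : ℕ → (A.Carrier → A[t].Carrier) → A[t][z].Carrier
  M d f = ∑ 𝔸[t][z] (monics d) λ b →
    const 𝔸[t] (f (poly b)) A[t][z].*
    ∏ 𝔸[t][z] (monicsExcept b) λ a → X 𝔸[t] A[t][z].- const 𝔸[t] (const 𝔸 (poly a))

  wagner : ℕ → (A.Carrier → A[t].Carrier) → K[t].Carrier
  wagner d f =
    (K[t].- K[t].1#) K[t].^ d K[t].* constK (L d / D d [ D≉0 d ]) K[t].* ι (eval 𝔸[t] (M d f) A[t].0#)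

{-# OPTIONS --safe #-}
-- The signs and L_d cancel, so the right-hand side is M_d(χₜ)(0) / D_d, and it
-- suffices that b ∏_{a ≠ b} (-a) = D_d for every monic b of degree d.  Multiplied
-- by -1 this reads (-1)^(qᵈ) D_d = - D_d.  Now (-1)^(q-1) = 1 in 𝔽_q, because
-- negation permutes the nonzero elements and hence fixes their product; therefore
-- (-1)^q = -1 and (-1)^(qᵈ) = -1.
module Submission where

open import Defs
open import Algebra.Bundles using (CommutativeRing)
open import Algebra.Morphism.Structures using (module RingMorphisms)
import Algebra.Properties.Semiring.Exp as Exp
open import Data.Fin.Base using (Fin; zero; suc; punchIn)
open import Data.Fin.Permutation using (Permutation; permutation; remove; punchIn-permute; _⟨$⟩ʳ_)
open import Data.Fin.Properties using (punchInᵢ≢i)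
open import Data.List.Base using (List; []; _∷_; map; filter; length; allFin; cartesianProductWith)
open import Data.List.Properties using (filter-accept; filter-all; filter-reject; length-++; length-map; length-tabulate)
import Data.List.Membership.Setoid as SetoidMembership
import Data.List.Relation.Unary.All as All
open import Data.List.Relation.Unary.AllPairs using (_∷_)
open import Data.List.Relation.Unary.Any using (here; there)
import Data.List.Relation.Unary.Unique.Setoid as SetoidUnique
open import Data.Nat.Base as ℕ using (ℕ; zero; suc)
open import Data.Product.Base using (_,_)
open import Data.Sum.Base using (inj₁; inj₂)
open import Function.Base using (id; _∘_)
open import Level using (Level)
open import Relation.Binary.Bundles using (DecSetoid)
open import Relation.Binary.PropositionalEquality as ≡ using (_≡_)
open import Relation.Nullary using (¬_; contradiction)
open import Relation.Nullary.Decidable using (¬?)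

open RingMorphisms using (IsRingHomomorphism)

private
  variable
    i c ℓ c′ ℓ′ : Level

-- Lengths of lists, signs, and finite sums and products in a commutative ring.

length-cartesianProductWith : ∀ {a b c} {A : Set a} {B : Set b} {C : Set c} (f : A → B → C) xs ys →
  length (cartesianProductWith f xs ys) ≡ length xs ℕ.* length ys
length-cartesianProductWith f []       ys = ≡.refl
length-cartesianProductWith f (x ∷ xs) ys = ≡.trans (length-++ (map (f x) ys))
  (≡.cong₂ ℕ._+_ (length-map (f x) ys) (length-cartesianProductWith f xs ys))

module _ (R : CommutativeRing c ℓ) where

  open CommutativeRing R
  open import Algebra.Properties.CommutativeSemigroup *-commutativeSemigroup using (interchange)
  open import Algebra.Properties.CommutativeSemiring.Exp commutativeSemiring using (_^_; ^-congˡ; ^-distrib-*)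
  open import Algebra.Properties.Ring ring using (-1*x≈-x; -‿involutive)
  open import Relation.Binary.Reasoning.Setoid setoid

  1^n≈1 : ∀ n → 1# ^ n ≈ 1#
  1^n≈1 zero    = refl
  1^n≈1 (suc n) = trans (*-identityˡ _) (1^n≈1 n)

  -- Cancels the sign in the definition of the Wagner coefficient against the sign in the theorem.
  [-1]ⁿ*[-1]ⁿ≈1 : ∀ n → (- 1#) ^ n * (- 1#) ^ n ≈ 1#
  [-1]ⁿ*[-1]ⁿ≈1 n = begin
    (- 1#) ^ n * (- 1#) ^ n  ≈⟨ ^-distrib-* (- 1#) (- 1#) n ⟨
    (- 1# * - 1#) ^ n        ≈⟨ ^-congˡ n (trans (-1*x≈-x (- 1#)) (-‿involutive 1#)) ⟩
    1# ^ n                   ≈⟨ 1^n≈1 n ⟩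
    1#                       ∎

  ∑-cong : {I : Set i} {f g : I → Carrier} (xs : List I) → (∀ x → f x ≈ g x) → ∑ R xs f ≈ ∑ R xs g
  ∑-cong []       e = refl
  ∑-cong (x ∷ xs) e = +-cong (e x) (∑-cong xs e)

  ∏-cong : {I : Set i} {f g : I → Carrier} (xs : List I) → (∀ x → f x ≈ g x) → ∏ R xs f ≈ ∏ R xs g
  ∏-cong []       e = refl
  ∏-cong (x ∷ xs) e = *-cong (e x) (∏-cong xs e)

  *-distribˡ-∑ : {I : Set i} (y : Carrier) (xs : List I) (f : I → Carrier) →
    y * ∑ R xs f ≈ ∑ R xs (λ x → y * f x)
  *-distribˡ-∑ y []       f = zeroʳ y
  *-distribˡ-∑ y (x ∷ xs) f = trans (distribˡ y _ _) (+-congˡ (*-distribˡ-∑ y xs f))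

  ∏-neg : {I : Set i} (xs : List I) (f : I → Carrier) →
    ∏ R xs (λ x → - f x) ≈ (- 1#) ^ length xs * ∏ R xs f
  ∏-neg []       f = sym (*-identityˡ 1#)
  ∏-neg (x ∷ xs) f = begin
    - f x * ∏ R xs (λ x → - f x)                        ≈⟨ *-cong (sym (-1*x≈-x (f x))) (∏-neg xs f) ⟩
    (- 1# * f x) * ((- 1#) ^ length xs * ∏ R xs f)      ≈⟨ interchange _ _ _ _ ⟩
    (- 1# * (- 1#) ^ length xs) * (f x * ∏ R xs f)      ∎

  module _ (S : DecSetoid c′ ℓ′) where

    private module S = DecSetoid S
    open SetoidMembership S.setoid using (_∈_)
    open SetoidUnique S.setoid using (Unique)

    -- The list has no repetitions, so the filter removes exactly one entry, and `f x` restores its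
    -- factor. That entry is equal to `x` only up to `S.≈`, which is why `f` has to respect this
    -- relation.
    ∏-except : (f : S.Carrier → Carrier) → (∀ {x y} → x S.≈ y → f x ≈ f y) →
      ∀ {x xs} → Unique xs → x ∈ xs →
      f x * ∏ R (filter (λ y → ¬? (y S.≟ x)) xs) f ≈ ∏ R xs f
    ∏-except f f-cong {x} {y ∷ xs} (y≉xs ∷ _) (here x≈y)
      rewrite filter-reject (λ y → ¬? (y S.≟ x)) {y} {xs} (λ y≉x → y≉x (S.sym x≈y))
            | filter-all (λ y → ¬? (y S.≟ x)) (All.map (λ y≉z z≈x → y≉z (S.sym (S.trans z≈x x≈y))) y≉xs)
      = *-congʳ (f-cong x≈y)
    -- The head differs from the later entry that equals `x`, so the filter keeps it.
    ∏-except f f-cong {x} {y ∷ xs} (y≉xs ∷ xs-unique) (there x∈xs)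
      rewrite filter-accept (λ y → ¬? (y S.≟ x)) {y} {xs}
                (λ y≈x → let y≉z , x≈z = All.lookupAny y≉xs x∈xs in y≉z (S.trans y≈x x≈z))
      = trans (x∙yz≈y∙xz _ _ _) (*-congˡ (∏-except f f-cong xs-unique x∈xs))
      where open import Algebra.Properties.CommutativeSemigroup *-commutativeSemigroup using (x∙yz≈y∙xz)

-- Ring homomorphisms: sums, products, powers, and their coefficientwise extension to polynomials.

module _ (R : CommutativeRing c ℓ) (S : CommutativeRing c′ ℓ′) where

  private
    module R = CommutativeRing R
    module S = CommutativeRing S
    module P = Polynomial S
    module P[X] = CommutativeRing (Polynomial.polynomialRing S)
    open Exp R.semiring renaming (_^_ to _^ᴿ_)
    open Exp S.semiring renaming (_^_ to _^ˢ_)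

  module _ {h : R.Carrier → S.Carrier} (isHom : IsRingHomomorphism R.rawRing S.rawRing h) where

    open IsRingHomomorphism isHom

    ∑-homo : {I : Set i} (xs : List I) (f : I → R.Carrier) → h (∑ R xs f) S.≈ ∑ S xs (h ∘ f)
    ∑-homo []       f = 0#-homo
    ∑-homo (x ∷ xs) f = S.trans (+-homo _ _) (S.+-congˡ (∑-homo xs f))

    ∏-homo : {I : Set i} (xs : List I) (f : I → R.Carrier) → h (∏ R xs f) S.≈ ∏ S xs (h ∘ f)
    ∏-homo []       f = 1#-homo
    ∏-homo (x ∷ xs) f = S.trans (*-homo _ _) (S.*-congˡ (∏-homo xs f))

    ^-homo : ∀ x n → h (x ^ᴿ n) S.≈ h x ^ˢ n
    ^-homo x zero    = 1#-homo
    ^-homo x (suc n) = S.trans (*-homo _ _) (S.*-congˡ (^-homo x n))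

    -- Horner's rule at the indeterminate rebuilds the list of images coefficient by coefficient.
    -- Thus `map h` inherits the homomorphism laws already known for evaluation.
    map≋evalVia : ∀ p → map h p P.≋ Evaluation.evalVia R (Polynomial.polynomialRing S) (P.const ∘ h) P.X p
    map≋evalVia []      = P.≋-refl
    map≋evalVia (a ∷ p) = P.≋-sym (P.≋-trans
      (P.⊕-cong (P.≋-refl {P.const (h a)})
        (P.≋-trans (P.shift-⊗ (P.const S.1#) _)
          (P.∷-cong S.refl (P.≋-trans (P.⊗-identityˡ _) (P.≋-sym (map≋evalVia p))))))
      (P.∷-cong (S.+-identityʳ (h a)) P.≋-refl))

    map-isRingHomomorphism :
      IsRingHomomorphism (CommutativeRing.rawRing (Polynomial.polynomialRing R)) P[X].rawRing (map h)
    map-isRingHomomorphism = record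
      { isSemiringHomomorphism = record
        { isNearSemiringHomomorphism = record
          { +-isMonoidHomomorphism = record
            { isMagmaHomomorphism = record
              { isRelHomomorphism = record
                { cong = λ {p} {q} e → via p (P.≋-trans (E.⟦⟧-cong e) (P.≋-sym (map≋evalVia q))) }
              ; homo = λ p q → via (p A.+ q) (P.≋-trans (E.+-homo p q)
                  (P[X].+-cong (P.≋-sym (map≋evalVia p)) (P.≋-sym (map≋evalVia q)))) }
            ; ε-homo = P.≋-refl }
          ; *-homo = λ p q → via (p A.* q) (P.≋-trans (E.*-homo p q)
              (P[X].*-cong (P.≋-sym (map≋evalVia p)) (P.≋-sym (map≋evalVia q)))) }
        ; 1#-homo = P.∷-cong 1#-homo P.≋-refl }
      ; -‿homo = λ p → via (A.- p) (P.≋-trans (E.-‿homo p)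
          (P[X].-‿cong (P.≋-sym (map≋evalVia p)))) }
      where
      module A = CommutativeRing (Polynomial.polynomialRing R)
      open import Algebra.Morphism.Construct.Composition using (isRingHomomorphism)
      module E = IsRingHomomorphism (Evaluation.evalVia-isRingHomomorphism R (Polynomial.polynomialRing S)
        (isRingHomomorphism P[X].trans isHom (const-isRingHomomorphism S)) P.X)
      via : ∀ p {q} → Evaluation.evalVia R (Polynomial.polynomialRing S) (P.const ∘ h) P.X p P.≋ q → map h p P.≋ q
      via p = P.≋-trans (map≋evalVia p)

id-isRingHomomorphism : (R : CommutativeRing c ℓ) →
  IsRingHomomorphism (CommutativeRing.rawRing R) (CommutativeRing.rawRing R) id
id-isRingHomomorphism R = isRingHomomorphism (CommutativeRing.rawRing R) (CommutativeRing.refl R)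
  where open import Algebra.Morphism.Construct.Identity using (isRingHomomorphism)

fromDomain-isRingHomomorphism : (D : IntegralDomain c ℓ) → let open Fractions D in
  IsRingHomomorphism (IntegralDomain.rawRing D) (CommutativeRing.rawRing fractionField) fromDomain
fromDomain-isRingHomomorphism D = record
  { isSemiringHomomorphism = record
    { isNearSemiringHomomorphism = record
      { +-isMonoidHomomorphism = record
        { isMagmaHomomorphism = record
          { isRelHomomorphism = record { cong = λ e → mk≃ (*-congʳ e) }
          ; homo = λ x y → mk≃ (*-cong (sym (+-cong (*-identityʳ x) (*-identityʳ y))) (*-identityˡ 1#)) }
        ; ε-homo = mk≃ refl }
      ; *-homo = λ x y → mk≃ (*-congˡ (*-identityˡ 1#)) }
    ; 1#-homo = mk≃ refl }
  ; -‿homo = λ _ → mk≃ refl }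
  where
  open IntegralDomain D
  open Fractions D

-- Powers of -1 in a finite field.

module _ {q : ℕ} (F : FiniteField c ℓ q) where

  open FunctionField F

  -- Negation is carried over to indices by the enumeration, because the invariance of products
  -- under permutations is stated for `Fin`.
  negate : Permutation q q
  negate = permutation neg neg neg-neg neg-neg
    where
    open import Algebra.Properties.Ring F.ring using (-‿involutive)
    neg : Fin q → Fin q
    neg i = F.from (F.- F.to i)
    neg-neg : ∀ i → neg (neg i) ≡ i
    neg-neg i = F.inverseʳ (F.trans (F.-‿cong (F.inverseˡ ≡.refl)) (-‿involutive (F.to i)))

module _ {n : ℕ} (F : FiniteField c ℓ (suc n)) where

  open FunctionField F
  open import Algebra.Properties.CommutativeMonoid.Sum F.*-commutativeMonoid
    renaming (sum to product; sum-cong-≋ to product-cong; sum-permute to product-permute;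
              sum-replicate to product-replicate; ∑-distrib-+ to product-distrib-*)
  open import Algebra.Properties.Ring F.ring using (-1*x≈-x; -0#≈0#)
  open Exp F.semiring using (_^_)
  open import Relation.Binary.Reasoning.Setoid F.setoid

  private
    i₀ : Fin (suc n)
    i₀ = F.from F.0#

    -- Skipping the index of zero lists the `n` = q - 1 nonzero elements of the field.
    unit : Fin n → F.Carrier
    unit j = F.to (punchIn i₀ j)

    unit≉0 : ∀ j → ¬ unit j F.≈ F.0#
    unit≉0 j e = punchInᵢ≢i i₀ j (≡.sym (F.inverseʳ (F.sym e)))

    product≉0 : ∀ {m} (f : Fin m → F.Carrier) → (∀ j → ¬ f j F.≈ F.0#) → ¬ product f F.≈ F.0#
    product≉0 {zero}  f f≉0 e = F.1≉0 e
    product≉0 {suc m} f f≉0 e with F-noZeroDivisors _ _ e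
    ... | inj₁ f₀≈0 = f≉0 zero f₀≈0
    ... | inj₂ fs≈0 = product≉0 (f ∘ suc) (f≉0 ∘ suc) fs≈0

    -- The restriction of negation to the nonzero elements, as `unit-negate` confirms.
    negateUnits : Permutation n n
    negateUnits = remove i₀ (negate F)

    unit-negate : ∀ j → unit (negateUnits ⟨$⟩ʳ j) F.≈ F.- unit j
    unit-negate j = begin
      F.to (punchIn i₀ (negateUnits ⟨$⟩ʳ j))
        -- After `remove`, the skipped index on the target side is the image of `i₀` under negation.
        -- It equals `i₀` because -0 = 0.
        ≡⟨ ≡.cong (λ i → F.to (punchIn i (negateUnits ⟨$⟩ʳ j))) (F.from-cong -0≈0) ⟨
      F.to (punchIn (negate F ⟨$⟩ʳ i₀) (negateUnits ⟨$⟩ʳ j))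
        ≡⟨ ≡.cong F.to (punchIn-permute (negate F) i₀ j) ⟨
      F.to (negate F ⟨$⟩ʳ punchIn i₀ j)   ≈⟨ F.inverseˡ ≡.refl ⟩
      F.- unit j                          ∎
      where
      -0≈0 : F.- F.to i₀ F.≈ F.0#
      -0≈0 = F.trans (F.-‿cong (F.inverseˡ ≡.refl)) -0#≈0#

  -- Drawing a factor -1 out of each negated unit shows that (-1)^(q-1) fixes the product of the
  -- units. This product is nonzero and can be cancelled. The argument is uniform in the
  -- characteristic.
  [-1]^[q-1]≈1 : (F.- F.1#) ^ n F.≈ F.1#
  [-1]^[q-1]≈1 with F-noZeroDivisors ((F.- F.1#) ^ n F.- F.1#) (product unit) vanishes
    where
    open import Algebra.Properties.Ring F.ring using ([y-z]x≈yx-zx)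
    open import Algebra.Properties.Group F.+-group using (x≈y⇒x∙y⁻¹≈ε)
    fixed : (F.- F.1#) ^ n F.* product unit F.≈ F.1# F.* product unit
    fixed = begin
      (F.- F.1#) ^ n F.* product unit                    ≈⟨ F.*-congʳ (product-replicate n) ⟨
      product {n} (λ _ → F.- F.1#) F.* product unit      ≈⟨ product-distrib-* {n} (λ _ → F.- F.1#) unit ⟨
      product (λ j → F.- F.1# F.* unit j)                ≈⟨ product-cong (λ j → F.trans (-1*x≈-x (unit j)) (F.sym (unit-negate j))) ⟩
      product (λ j → unit (negateUnits ⟨$⟩ʳ j))          ≈⟨ product-permute unit negateUnits ⟨
      product unit                                       ≈⟨ F.*-identityˡ _ ⟨
      F.1# F.* product unit                              ∎
    vanishes : ((F.- F.1#) ^ n F.- F.1#) F.* product unit F.≈ F.0#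
    vanishes = F.trans ([y-z]x≈yx-zx (product unit) _ F.1#) (x≈y⇒x∙y⁻¹≈ε fixed)
  ... | inj₁ e = x∙y⁻¹≈ε⇒x≈y _ _ e
    where open import Algebra.Properties.Group F.+-group using (x∙y⁻¹≈ε⇒x≈y)
  ... | inj₂ e = contradiction e (product≉0 unit unit≉0)

[-1]^q≈-1 : ∀ {q} (F : FiniteField c ℓ q) → let open FiniteField F; open Exp semiring in
  (- 1#) ^ q ≈ - 1#
-- A field has an element 0, whose index would lie in the empty `Fin 0`.
[-1]^q≈-1 {q = zero}  F with () ← FunctionField.F.from F (FiniteField.0# F)
[-1]^q≈-1 {q = suc n} F = trans (*-congˡ ([-1]^[q-1]≈1 F)) (*-identityʳ _)
  where open FiniteField F

-- Monic polynomials of degree d, their cofactors, and the value of M_d(f) at z = 0.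

module _ {q : ℕ} (F : FiniteField c ℓ q) where

  open FunctionField F
  open Exp A.semiring using (_^_; ^-congˡ; ^-congʳ; ^-assocʳ)
  open Exp F.semiring using () renaming (_^_ to _^ᶠ_)

  length-monics : ∀ d → length (monics d) ≡ q ℕ.^ d
  length-monics zero    = ≡.refl
  length-monics (suc d) = ≡.trans (length-cartesianProductWith extend F-elements (monics d))
    (≡.cong₂ ℕ._*_ (≡.trans (length-map F.to (allFin q)) (length-tabulate (id {A = Fin q}))) (length-monics d))

  -- Induction on `d`, splitting the exponent as q times q^d. The inner q-th power is computed in
  -- the field of constants, since -1 in `𝔸` is by definition the constant polynomial -1.
  [-1]^qᵈ≈-1 : ∀ d → (A.- A.1#) ^ (q ℕ.^ d) A.≈ A.- A.1#
  [-1]^qᵈ≈-1 zero    = A.*-identityʳ _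
  [-1]^qᵈ≈-1 (suc d) = begin
    (A.- A.1#) ^ (q ℕ.* q ℕ.^ d)                                ≈⟨ ^-assocʳ (A.- A.1#) q (q ℕ.^ d) ⟨
    ((A.- A.1#) ^ q) ^ (q ℕ.^ d)                                ≈⟨ ^-congˡ (q ℕ.^ d) (^-homo F.commutativeRing 𝔸 const-hom (F.- F.1#) q) ⟨
    Polynomial.const F.commutativeRing ((F.- F.1#) ^ᶠ q) ^ (q ℕ.^ d)  ≈⟨ ^-congˡ (q ℕ.^ d) (A.∷-cong ([-1]^q≈-1 F) A.refl) ⟩
    (A.- A.1#) ^ (q ℕ.^ d)                                      ≈⟨ [-1]^qᵈ≈-1 d ⟩
    A.- A.1#                                                    ∎
    where
    open import Relation.Binary.Reasoning.Setoid A.setoid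
    const-hom = const-isRingHomomorphism F.commutativeRing

  -- Equality is decided exactly as in `monicsExcept`, so the filtered list in `∏-except` is that
  -- list by definition.
  A₊-decSetoid : ℕ → DecSetoid _ _
  A₊-decSetoid d = record
    { Carrier = A₊ d ; _≈_ = λ a b → poly a A.≈ poly b
    ; isDecEquivalence = record
      { isEquivalence = record { refl = A.refl ; sym = A.sym ; trans = A.trans }
      ; _≟_ = λ a b → poly a ≟ poly b } }

  -- The value at z = 0 of the product that multiplies f(b) in M_d(f).
  cofactor : ∀ {d} → A₊ d → A.Carrier
  cofactor b = ∏ 𝔸 (monicsExcept b) λ a → A.- poly a

  -- Negating the left side supplies the factor -b that the cofactor lacks. The completed product of
  -- all -a is (-1)^(q^d) D_d = -D_d, and negation is injective.
  b*cofactor≈D : ∀ {d} (b : A₊ d) → poly b A.* cofactor b A.≈ D d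
  b*cofactor≈D {d} b = -‿injective (begin
    A.- (poly b A.* cofactor b)
      ≈⟨ -‿distribˡ-* (poly b) (cofactor b) ⟩
    A.- poly b A.* cofactor b
      ≈⟨ ∏-except 𝔸 (A₊-decSetoid d) (λ a → A.- poly a) (λ {a} {b} → A.-‿cong {poly a} {poly b})
           {x = b} (monics-unique d) (∈-monics b) ⟩
    ∏ 𝔸 (monics d) (λ a → A.- poly a)
      ≈⟨ ∏-neg 𝔸 (monics d) poly ⟩
    (A.- A.1#) ^ length (monics d) A.* D d
      ≈⟨ A.*-congʳ {D d} {(A.- A.1#) ^ length (monics d)} (A.trans (^-congʳ (A.- A.1#) (length-monics d)) ([-1]^qᵈ≈-1 d)) ⟩
    A.- A.1# A.* D d
      ≈⟨ -1*x≈-x (D d) ⟩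
    A.- D d ∎)
    where
    open import Relation.Binary.Reasoning.Setoid A.setoid
    open import Algebra.Properties.Ring A.ring using (-‿distribˡ-*; -1*x≈-x; -‿injective)

  -- Evaluation at z = 0 is a ring homomorphism, so it acts inside the sum and the products, turning
  -- each factor z - a into -a.
  M[0] : ∀ d (f : A.Carrier → A[t].Carrier) →
    eval 𝔸[t] (M d f) A[t].0# A[t].≈
    ∑ 𝔸[t] (monics d) λ b → f (poly b) A[t].* Polynomial.const 𝔸 (cofactor b)
  M[0] d f = A[t].trans (∑-homo 𝔸[t][z] 𝔸[t] ev-hom (monics d) _)
    (∑-cong 𝔸[t] (monics d) λ b → A[t].trans
      (ev.*-homo (Polynomial.const 𝔸[t] (f (poly b))) (∏ 𝔸[t][z] (monicsExcept b) factor))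
      (A[t].*-cong {x = eval 𝔸[t] (Polynomial.const 𝔸[t] (f (poly b))) A[t].0#} {y = f (poly b)}
        (ev-const (f (poly b))) (product-at-0 (monicsExcept b))))
    where
    id-hom = id-isRingHomomorphism 𝔸[t]
    ev-hom = Evaluation.evalVia-isRingHomomorphism 𝔸[t] 𝔸[t] id-hom A[t].0#
    ev-const = Evaluation.ev-const 𝔸[t] 𝔸[t] id-hom A[t].0#
    ev-X = Evaluation.ev-X 𝔸[t] 𝔸[t] id-hom A[t].0#
    module ev = IsRingHomomorphism ev-hom
    factor : A₊ d → A[t][z].Carrier
    factor a = Polynomial.X 𝔸[t] A[t][z].- Polynomial.const 𝔸[t] (Polynomial.const 𝔸 (poly a))
    factor-at-0 : ∀ a → eval 𝔸[t] (factor a) A[t].0# A[t].≈ Polynomial.const 𝔸 (A.- poly a)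
    factor-at-0 a = A[t].trans (ev.+-homo (Polynomial.X 𝔸[t]) (A[t][z].- Polynomial.const 𝔸[t] p))
      -- The result 0 + (-a) is the constant -a by computation, as `[]` is a definitional left unit
      -- and negation acts coefficientwise.
      (A[t].+-cong {x = eval 𝔸[t] (Polynomial.X 𝔸[t]) A[t].0#} {y = A[t].0#} ev-X
        (A[t].trans (ev.-‿homo (Polynomial.const 𝔸[t] p)) (A[t].-‿cong (ev-const p))))
      where p = Polynomial.const 𝔸 (poly a)
    product-at-0 : (as : List (A₊ d)) →
      eval 𝔸[t] (∏ 𝔸[t][z] as factor) A[t].0# A[t].≈ Polynomial.const 𝔸 (∏ 𝔸 as λ a → A.- poly a)
    product-at-0 as = A[t].trans (∏-homo 𝔸[t][z] 𝔸[t] ev-hom as _)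
      -- All factors are now constants in t, so their product is the constant given by the product
      -- taken in `𝔸`.
      (A[t].trans (∏-cong 𝔸[t] as factor-at-0)
        (A[t].sym (∏-homo 𝔸 𝔸[t] (const-isRingHomomorphism 𝔸) as _)))

  -- Both sides of the identity in K[t].

  ι-isRingHomomorphism : IsRingHomomorphism A[t].rawRing K[t].rawRing ι
  ι-isRingHomomorphism = map-isRingHomomorphism 𝔸 𝕂 (fromDomain-isRingHomomorphism A-integralDomain)

  open import Relation.Binary.Reasoning.Setoid K[t].setoid

  private
    module ι = IsRingHomomorphism ι-isRingHomomorphism
    module constK = IsRingHomomorphism (const-isRingHomomorphism 𝕂)

  -- Each 1/a equals the cofactor of a divided by D_d. The common factor 1/D_d leaves the sum, and
  -- what remains is the image under `ι` of the formula in `M[0]`.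
  ∑f/a≈M[0]/D : ∀ d (f : A.Carrier → A[t].Carrier) →
    ∑ 𝕂[t] (monics d) (λ a → ι (f (poly a)) K[t].* constK (A.1# / poly a [ poly≉0 a ])) K[t].≈
    constK (A.1# / D d [ D≉0 d ]) K[t].* ι (eval 𝔸[t] (M d f) A[t].0#)
  ∑f/a≈M[0]/D d f = begin
    ∑ 𝕂[t] (monics d) (λ a → ι (f (poly a)) K[t].* constK (A.1# / poly a [ poly≉0 a ]))
      ≈⟨ ∑-cong 𝕂[t] (monics d) term ⟩
    ∑ 𝕂[t] (monics d) (λ a → 1/D K[t].* ι (f (poly a) A[t].* Polynomial.const 𝔸 (cofactor a)))
      ≈⟨ *-distribˡ-∑ 𝕂[t] 1/D (monics d) _ ⟨
    1/D K[t].* ∑ 𝕂[t] (monics d) (λ a → ι (f (poly a) A[t].* Polynomial.const 𝔸 (cofactor a)))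
      ≈⟨ K[t].*-congˡ {1/D} (∑-homo 𝔸[t] 𝕂[t] ι-isRingHomomorphism (monics d) _) ⟨
    1/D K[t].* ι (∑ 𝔸[t] (monics d) λ a → f (poly a) A[t].* Polynomial.const 𝔸 (cofactor a))
      ≈⟨ K[t].*-congˡ {1/D} (ι.⟦⟧-cong (M[0] d f)) ⟨
    1/D K[t].* ι (eval 𝔸[t] (M d f) A[t].0#) ∎
    where
    open import Algebra.Properties.CommutativeSemigroup K[t].*-commutativeSemigroup using (x∙yz≈y∙xz)
    open Fractions A-integralDomain using (mk≃)
    1/D = constK (A.1# / D d [ D≉0 d ])
    -- Cross-multiplied, and up to factors 1, this is `b*cofactor≈D`.
    1/a : ∀ (a : A₊ d) → (A.1# / poly a [ poly≉0 a ]) K.≈ (A.1# / D d [ D≉0 d ]) K.* fromDomain (cofactor a)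
    1/a a = mk≃ (A.trans (A.*-identityˡ _) (A.trans (A.*-identityʳ (D d))
      (A.trans (A.sym (b*cofactor≈D a)) (A.trans (A.*-comm (poly a) (cofactor a))
      (A.*-congʳ {poly a} (A.sym (A.*-identityˡ (cofactor a))))))))
    term : ∀ a → ι (f (poly a)) K[t].* constK (A.1# / poly a [ poly≉0 a ]) K[t].≈
                 1/D K[t].* ι (f (poly a) A[t].* Polynomial.const 𝔸 (cofactor a))
    term a = begin
      ι (f (poly a)) K[t].* constK (A.1# / poly a [ poly≉0 a ])
        ≈⟨ K[t].*-congˡ {ι (f (poly a))} (K[t].trans (constK.⟦⟧-cong (1/a a))
             (constK.*-homo (A.1# / D d [ D≉0 d ]) (fromDomain (cofactor a)))) ⟩
      ι (f (poly a)) K[t].* (1/D K[t].* constK (fromDomain (cofactor a)))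
        ≈⟨ x∙yz≈y∙xz (ι (f (poly a))) 1/D _ ⟩
      1/D K[t].* (ι (f (poly a)) K[t].* constK (fromDomain (cofactor a)))
        -- By definition, `ι` sends the constant `cofactor a` to `constK (fromDomain (cofactor a))`.
        ≈⟨ K[t].*-congˡ {1/D} (ι.*-homo (f (poly a)) (Polynomial.const 𝔸 (cofactor a))) ⟨
      1/D K[t].* ι (f (poly a) A[t].* Polynomial.const 𝔸 (cofactor a)) ∎

  -- Regrouping brings together the two signs, whose product is 1, and the fractions L_d/D_d and
  -- 1/L_d, whose product is 1/D_d.
  wagner/L : ∀ d (f : A.Carrier → A[t].Carrier) →
    (K[t].- K[t].1#) K[t].^ d K[t].* (wagner d f K[t].* constK (A.1# / L d [ L≉0 d ])) K[t].≈
    constK (A.1# / D d [ D≉0 d ]) K[t].* ι (eval 𝔸[t] (M d f) A[t].0#)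
  wagner/L d f = begin
    s K[t].* (((s K[t].* L/D) K[t].* m) K[t].* 1/L)
      ≈⟨ solve 4 (λ s x m y → s :* (((s :* x) :* m) :* y) := (s :* s) :* ((x :* y) :* m)) K[t].refl s L/D m 1/L ⟩
    (s K[t].* s) K[t].* ((L/D K[t].* 1/L) K[t].* m)
      ≈⟨ K[t].*-cong {x = s K[t].* s} {y = K[t].1#} ([-1]ⁿ*[-1]ⁿ≈1 𝕂[t] d)
           (K[t].*-congʳ {m} {L/D K[t].* 1/L} (K[t].trans
             (K[t].sym (constK.*-homo (L d / D d [ D≉0 d ]) (A.1# / L d [ L≉0 d ])))
             (constK.⟦⟧-cong L/D*1/L))) ⟩
    K[t].1# K[t].* (constK (A.1# / D d [ D≉0 d ]) K[t].* m)
      ≈⟨ K[t].*-identityˡ _ ⟩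
    constK (A.1# / D d [ D≉0 d ]) K[t].* m ∎
    where
    open import Algebra.Solver.Ring.NaturalCoefficients.Default K[t].commutativeSemiring using (solve; _:=_; _:*_)
    open Fractions A-integralDomain using (mk≃)
    s   = (K[t].- K[t].1#) K[t].^ d
    L/D = constK (L d / D d [ D≉0 d ])
    1/L = constK (A.1# / L d [ L≉0 d ])
    m   = ι (eval 𝔸[t] (M d f) A[t].0#)
    L/D*1/L : (L d / D d [ D≉0 d ]) K.* (A.1# / L d [ L≉0 d ]) K.≈ (A.1# / D d [ D≉0 d ])
    L/D*1/L = mk≃ (A.trans (A.*-congʳ {D d} (A.*-identityʳ (L d)))
      (A.trans (A.*-comm (L d) (D d)) (A.sym (A.*-identityˡ _))))

theorem4p2p2 : ∀ {c ℓ} (q : ℕ) → IsPrimePower q → (F : FiniteField c ℓ q) → let open FunctionField F in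
    (d : ℕ) →
    ∑ 𝕂[t] (monics d) (λ a → ι (χₜ (poly a)) K[t].* constK (A.1# / poly a [ poly≉0 a ]))
      K[t].≈
    (K[t].- K[t].1#) K[t].^ d K[t].* (wagner d χₜ K[t].* constK (A.1# / L d [ L≉0 d ]))
theorem4p2p2 q _ F d = K[t].trans (∑f/a≈M[0]/D F d χₜ) (K[t].sym (wagner/L F d χₜ))
  where open FunctionField F
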